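{- Let $n$ and $k$ be positive integers such that either (1) $k$ is even, $4 \mid kn$ and $n \ge k/2+2$, or (2) $k$ is odd and $k \mid n$. Then the upper bound $f(n,k,0)\le \frac{n}{k}\lfloor \frac{k^2}{4}\rfloor + n+1$ is attained, i.e. $$ f(n,k,0) = \frac{n}{k} \left\lfloor \frac{k^2}{4} \right\rfloor + n + 1. $$
   Context: Let $[n]=\{1,\dots,n\}$. For non-negative integers $k,\lambda$, a family (set of distinct subsets) $\mathcal{F}\subset 2^{[n]}$ is called $k$-almost $\lambda$-Fisher if for every $F\in\mathcal{F}$ there are at most $k$ other sets $F'\in\mathcal{F}\setminus\{F\}$ with $|F\cap F'|\neq\lambda$. Define $f(n,k,\lambda)=\max\{|\mathcal{F}| : \mathcal{F}\subset 2^{[n]} \text{ is a } k\text{ -almost } \lambda\text{ -Fisher family}\}$. The empty set is allowed as a member of $\mathcal{F}$. -}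

module Defs where

open import Data.Bool.Properties using () renaming (_≟_ to _≟ᵇ_)
open import Data.Fin using (Fin; zero; suc)
open import Data.Fin.Base using (funToFin; finToFun)
open import Data.Fin.Properties using (2↔Bool; finToFun-funToFin; injective⇒≤)
open import Data.Fin.Subset using (Subset; _∩_; ∣_∣)
open import Data.Fin.Subset.Properties using (anySubset?)
open import Data.List using (List; []; _∷_; length; filter; lookup)
open import Data.List.Membership.Propositional.Properties using (∈-lookup)
open import Data.List.Relation.Unary.All as All using (All; []; all?)
open import Data.List.Relation.Unary.AllPairs using ([]; _∷_)
open import Data.List.Relation.Unary.Unique.Propositional using (Unique)
import Data.List.Relation.Unary.Unique.DecPropositional as DecUnique
open import Data.Nat using (ℕ; zero; suc; _≤_; _^_; _≤?_; s≤s⁻¹)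
open import Data.Nat.Properties using (_≟_; ≤∧≢⇒<; suc-injective)
open import Data.Product using (∃; _×_; _,_; proj₁; proj₂)
open import Data.Vec as Vec using ()
open import Data.Vec.Properties using (≡-dec; tabulate-cong; tabulate∘lookup)
open import Function using (_∘_; Inverse)
open import Relation.Binary.Definitions using (DecidableEquality)
open import Relation.Binary.PropositionalEquality
open import Relation.Nullary using (Dec; yes; no; ¬?; contradiction)
open import Relation.Nullary.Decidable using (map′; _×-dec_)
open import Relation.Unary using (Decidable)

infix 4 _≟ˢ_
_≟ˢ_ : ∀ {n} → DecidableEquality (Subset n)
_≟ˢ_ = ≡-dec _≟ᵇ_

-- A set of subsets of [n], listed without repetition in some order.
record Family (n : ℕ) : Set where
  constructor family
  field
    members  : List (Subset n)
    distinct : Unique members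

open Family public

size : ∀ {n} → Family n → ℕ
size 𝓕 = length (members 𝓕)

-- The members F′ ≠ F with |F ∩ F′| ≠ l, where l is the parameter λ (a reserved
-- symbol in Agda).  As the members of a family are distinct, the length of this
-- list is the number of such F′.
exceptions : ∀ {n} → ℕ → List (Subset n) → Subset n → List (Subset n)
exceptions l Fs F =
  filter (λ F′ → ¬? (F′ ≟ˢ F) ×-dec ¬? (∣ F ∩ F′ ∣ ≟ l)) Fs

AlmostFisher : ∀ {n} → ℕ → ℕ → Family n → Set
AlmostFisher k l 𝓕 =
  All (λ F → length (exceptions l (members 𝓕) F) ≤ k) (members 𝓕)

IsMaximumSize : ℕ → ℕ → ℕ → ℕ → Set
IsMaximumSize n k l m =
  (∃ λ (𝓕 : Family n) → AlmostFisher k l 𝓕 × size 𝓕 ≡ m) ×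
  (∀ (𝓕 : Family n) → AlmostFisher k l 𝓕 → size 𝓕 ≤ m)

private
  lookup-injective : ∀ {A : Set} {xs : List A} → Unique xs →
                     ∀ {i j} → lookup xs i ≡ lookup xs j → i ≡ j
  lookup-injective (_ ∷ _)   {zero}  {zero}  _  = refl
  lookup-injective (x∉ ∷ _)  {zero}  {suc j} eq =
    contradiction eq (All.lookup x∉ (∈-lookup j))
  lookup-injective (x∉ ∷ _)  {suc i} {zero}  eq =
    contradiction (sym eq) (All.lookup x∉ (∈-lookup i))
  lookup-injective (_ ∷ xs!) {suc i} {suc j} eq =
    cong suc (lookup-injective xs! eq)

  module 2↔B = Inverse 2↔Bool

  encode : ∀ {n} → Subset n → Fin (2 ^ n)
  encode S = funToFin (2↔B.from ∘ Vec.lookup S)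

  decode : ∀ {n} → Fin (2 ^ n) → Subset n
  decode c = Vec.tabulate (2↔B.to ∘ finToFun c)

  decode-encode : ∀ {n} (S : Subset n) → decode (encode S) ≡ S
  decode-encode S = trans
    (tabulate-cong λ i → trans
      (cong 2↔B.to (finToFun-funToFin (2↔B.from ∘ Vec.lookup S) i))
      (2↔B.strictlyInverseˡ (Vec.lookup S i)))
    (tabulate∘lookup S)

  encode-injective : ∀ {n} {S T : Subset n} → encode S ≡ encode T → S ≡ T
  encode-injective {S = S} {T} eq =
    trans (sym (decode-encode S)) (trans (cong decode eq) (decode-encode T))

  size≤2^n : ∀ {n} (𝓕 : Family n) → size 𝓕 ≤ 2 ^ n
  size≤2^n 𝓕 = injective⇒≤ {f = encode ∘ lookup (members 𝓕)}
    (lookup-injective (distinct 𝓕) ∘ encode-injective)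

  anyList? : ∀ {n} {P : List (Subset n) → Set} → Decidable P →
             ∀ m → Dec (∃ λ xs → P xs × length xs ≡ m)
  anyList? P? zero =
    map′ (λ p → [] , p , refl) (λ { ([] , p , _) → p }) (P? [])
  anyList? P? (suc m) = map′
    (λ { (x , xs , p , eq) → x ∷ xs , p , cong suc eq })
    (λ { (x ∷ xs , p , eq) → x , xs , p , suc-injective eq })
    (anySubset? λ x → anyList? (λ xs → P? (x ∷ xs)) m)

  attained? : ∀ n k l m →
              Dec (∃ λ (𝓕 : Family n) → AlmostFisher k l 𝓕 × size 𝓕 ≡ m)
  attained? n k l m = map′
    (λ { (xs , (u , a) , eq) → family xs u , a , eq })
    (λ { (family xs u , a , eq) → xs , (u , a) , eq })
    (anyList? (λ xs → DecUnique.unique? _≟ˢ_ xs ×-dec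
                      all? (λ F → length (exceptions l xs F) ≤? k) xs) m)

  search : ∀ n k l b →
           (∀ (𝓕 : Family n) → AlmostFisher k l 𝓕 → size 𝓕 ≤ b) →
           ∃ (IsMaximumSize n k l)
  search n k l zero    bound = 0 , (family [] [] , [] , refl) , bound
  search n k l (suc b) bound with attained? n k l (suc b)
  ... | yes p = suc b , p , bound
  ... | no ¬p = search n k l b λ 𝓕 a →
        s≤s⁻¹ (≤∧≢⇒< (bound 𝓕 a) λ eq → ¬p (𝓕 , a , eq))

-- The maximum exists because sizes are at most 2 ^ n, attainment of a given size
-- is decidable, and the family with no members qualifies.
maximumSize : ∀ n k l → ∃ (IsMaximumSize n k l)
maximumSize n k l = search n k l (2 ^ n) λ 𝓕 _ → size≤2^n 𝓕

f : ℕ → ℕ → ℕ → ℕ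
f n k l = proj₁ (maximumSize n k l)

{-# OPTIONS --safe #-}
module Submission where

-- Write q for the integer part of k² / 4.  The claim is that k times the maximum
-- is n q + k n + k; the rational identity follows on dividing by k.
--
-- Upper bound.  Drop the empty set, which costs one member.  If some member
-- contains x but the singleton of x is no member, replace that member by the
-- singleton: the number of members stays the same, and intersections can only
-- disappear.  So the singletons of all covered points may be assumed to be
-- members; there are at most n of them.  Let B consist of the members with at
-- least two elements.  Each F in B meets its own singletons, hence meets,
-- counting itself, N(F) members of B with N(F) + ∣ F ∣ ≤ k + 1.  Let a(x) be the
-- number of members of B through x.  As a(x) is an integer,
-- k a(x) ≤ q + a(x)², and summing over x gives
--
--   k ∑ ∣ F ∣ ≤ n q + ∑ ∑ ∣ F ∩ G ∣     (F and G range over B).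
--
-- It remains to see that ∑ ∑ ∣ F ∩ G ∣ ≤ ∑ k (∣ F ∣ - 1), for then k ∣ B ∣ ≤ n q
-- (the lemma large-members).  With r = ∣ F ∣ - 1 and brackets for truth values,
--
--   ∣ F ∩ G ∣ + [ G ⊆ F ] ≤ r [ F meets G ] + [ F ⊆ G ] + [ G is near F ],
--
-- where G is near F if it is F or F with one element removed
-- (intersection-bound).  In the double sum the containment terms cancel, and F
-- has at most r² near sets in B (count-near), so the double sum is at most the
-- sum of r N(F) + r² = r (N(F) + r) ≤ r k.
--
-- Lower bound.  Take the empty set, all singletons and the edges of a graph.  An
-- edge meets the singletons of its two ends and deg x + deg y - 2 other edges, so
-- the family is k-almost 0-Fisher if deg x ≤ k for all x and deg x + deg y ≤ k
-- for all edges.  For k = 2h an h-regular circulant graph has n h / 2 = n q / k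
-- edges; for k = 2h + 1 and n = m k, the disjoint union of m complete bipartite
-- graphs with parts of sizes h and h + 1 has m h (h + 1) = n q / k edges.

open import Defs

-- Finite sums and counting

module Sums where

  open import Data.Bool using (if_then_else_)
  open import Data.Fin using (Fin; zero; suc)
  import Data.Fin.Properties as Fin
  open import Data.List
    using (List; []; _∷_; _++_; map; length; filter; tabulate; allFin; cartesianProduct)
  open import Data.List.Membership.Propositional using (_∈_)
  open import Data.List.Membership.Propositional.Properties
    using (∈-∃++; ∈-++⁻; ∈-++⁺ˡ; ∈-++⁺ʳ; ∈-map⁻; ∈-allFin)
  open import Data.List.Relation.Unary.All as All using ([]; _∷_)
  open import Data.List.Relation.Unary.AllPairs using ([]; _∷_)
  open import Data.List.Relation.Unary.Any using (here; there)
  open import Data.List.Relation.Unary.Unique.Propositional using (Unique)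
  import Data.List.Relation.Unary.Unique.Propositional.Properties as Unique
  open import Data.Nat using (ℕ; zero; suc; _+_; _*_; _≤_; z≤n; s≤s)
  open import Data.Nat.Properties
  open import Data.Nat.Tactic.RingSolver using (solve-∀)
  open import Data.Product using (∃; _×_; _,_)
  open import Data.Sum using (_⊎_; inj₁; inj₂; [_,_]′)
  open import Function using (_∘_)
  open import Relation.Binary.PropositionalEquality
  open import Relation.Nullary using (Dec; yes; no; ¬_; does; contradiction)
  open import Relation.Nullary.Decidable using (¬?; dec-true; dec-false)
  open import Relation.Unary using (Decidable)

  private variable
    A B : Set
    P Q R : Set

  -- The value 1 or 0 of a decidable proposition.
  𝟙 : Dec P → ℕ
  𝟙 d = if does d then 1 else 0

  𝟙-yes : (d : Dec P) → P → 𝟙 d ≡ 1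
  𝟙-yes d p rewrite dec-true d p = refl

  𝟙-no : (d : Dec P) → ¬ P → 𝟙 d ≡ 0
  𝟙-no d ¬p rewrite dec-false d ¬p = refl

  𝟙-≤ : (d : Dec P) {m : ℕ} → (P → 1 ≤ m) → 𝟙 d ≤ m
  𝟙-≤ (yes p) 1≤m = 1≤m p
  𝟙-≤ (no _)  _   = z≤n

  𝟙≤1 : (d : Dec P) → 𝟙 d ≤ 1
  𝟙≤1 d = 𝟙-≤ d λ _ → ≤-refl

  𝟙-mono : (d : Dec P) (e : Dec Q) → (P → Q) → 𝟙 d ≤ 𝟙 e
  𝟙-mono d e P⇒Q = 𝟙-≤ d λ p → ≤-reflexive (sym (𝟙-yes e (P⇒Q p)))

  𝟙-cong : (d : Dec P) (e : Dec Q) → (P → Q) → (Q → P) → 𝟙 d ≡ 𝟙 e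
  𝟙-cong d e P⇒Q Q⇒P = ≤-antisym (𝟙-mono d e P⇒Q) (𝟙-mono e d Q⇒P)

  𝟙-⊎ : (d : Dec P) (e : Dec Q) (g : Dec R) → (P → Q ⊎ R) → 𝟙 d ≤ 𝟙 e + 𝟙 g
  𝟙-⊎ d e g P⇒Q⊎R = 𝟙-≤ d λ p → [ left , right ]′ (P⇒Q⊎R p)
    where
    left  = λ q → ≤-trans (≤-reflexive (sym (𝟙-yes e q))) (m≤m+n (𝟙 e) (𝟙 g))
    right = λ r → ≤-trans (≤-reflexive (sym (𝟙-yes g r))) (m≤n+m (𝟙 g) (𝟙 e))

  -- The sum of the values of a function over the entries of a list, counted with
  -- multiplicity.
  ∑ : List A → (A → ℕ) → ℕ
  ∑ []       f = 0
  ∑ (x ∷ xs) f = f x + ∑ xs f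

  infix 8 ∑
  syntax ∑ xs (λ x → e) = ∑[ x ← xs ] e

  ∑-cong : ∀ (xs : List A) {f g} → (∀ {x} → x ∈ xs → f x ≡ g x) → ∑ xs f ≡ ∑ xs g
  ∑-cong []       eq = refl
  ∑-cong (x ∷ xs) eq = cong₂ _+_ (eq (here refl)) (∑-cong xs (eq ∘ there))

  ∑-mono : ∀ (xs : List A) {f g} → (∀ {x} → x ∈ xs → f x ≤ g x) → ∑ xs f ≤ ∑ xs g
  ∑-mono []       le = z≤n
  ∑-mono (x ∷ xs) le = +-mono-≤ (le (here refl)) (∑-mono xs (le ∘ there))

  ∑-+ : ∀ (xs : List A) {f g} → ∑[ x ← xs ] (f x + g x) ≡ ∑ xs f + ∑ xs g
  ∑-+ []               = refl
  ∑-+ (x ∷ xs) {f} {g} = trans (cong (f x + g x +_) (∑-+ xs))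
    (interchange (f x) (g x) (∑ xs f) (∑ xs g))
    where
    interchange : ∀ a b c d → a + b + (c + d) ≡ a + c + (b + d)
    interchange = solve-∀

  ∑-*ˡ : ∀ (xs : List A) c {f} → ∑[ x ← xs ] (c * f x) ≡ c * ∑ xs f
  ∑-*ˡ []       c     = sym (*-zeroʳ c)
  ∑-*ˡ (x ∷ xs) c {f} =
    trans (cong (c * f x +_) (∑-*ˡ xs c)) (sym (*-distribˡ-+ c (f x) (∑ xs f)))

  ∑-*ʳ : ∀ (xs : List A) c {f} → ∑[ x ← xs ] (f x * c) ≡ ∑ xs f * c
  ∑-*ʳ xs c {f} = trans (∑-cong xs λ {x} _ → *-comm (f x) c)
    (trans (∑-*ˡ xs c) (*-comm c (∑ xs f)))

  ∑-const : ∀ (xs : List A) c → ∑[ _ ← xs ] c ≡ length xs * c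
  ∑-const []       c = refl
  ∑-const (_ ∷ xs) c = cong (c +_) (∑-const xs c)

  ∑-zero : ∀ (xs : List A) {f} → (∀ {x} → x ∈ xs → f x ≡ 0) → ∑ xs f ≡ 0
  ∑-zero xs eq = trans (∑-cong xs eq) (trans (∑-const xs 0) (*-zeroʳ (length xs)))

  ∑-swap : ∀ (xs : List A) (ys : List B) {f : A → B → ℕ} →
           ∑[ x ← xs ] ∑[ y ← ys ] f x y ≡ ∑[ y ← ys ] ∑[ x ← xs ] f x y
  ∑-swap []       ys = sym (∑-zero ys λ _ → refl)
  ∑-swap (x ∷ xs) ys {f} =
    trans (cong (∑ ys (f x) +_) (∑-swap xs ys)) (sym (∑-+ ys))

  ∑-++ : ∀ (xs ys : List A) {f} → ∑ (xs ++ ys) f ≡ ∑ xs f + ∑ ys f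
  ∑-++ []       ys     = refl
  ∑-++ (x ∷ xs) ys {f} =
    trans (cong (f x +_) (∑-++ xs ys)) (sym (+-assoc (f x) (∑ xs f) (∑ ys f)))

  ∑-map : ∀ (xs : List A) (h : A → B) {f} → ∑ (map h xs) f ≡ ∑ xs (f ∘ h)
  ∑-map []       h     = refl
  ∑-map (x ∷ xs) h {f} = cong (f (h x) +_) (∑-map xs h)

  ∑-cartesianProduct : ∀ (xs : List A) (ys : List B) {f : A × B → ℕ} →
    ∑ (cartesianProduct xs ys) f ≡ ∑[ x ← xs ] ∑[ y ← ys ] f (x , y)
  ∑-cartesianProduct []       ys     = refl
  ∑-cartesianProduct (x ∷ xs) ys {f} =
    trans (∑-++ (map (x ,_) ys) (cartesianProduct xs ys))
          (cong₂ _+_ (∑-map ys (x ,_)) (∑-cartesianProduct xs ys))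

  ∑-tabulate : ∀ {n} (h : Fin n → A) {f} → ∑ (tabulate h) f ≡ ∑ (allFin n) (f ∘ h)
  ∑-tabulate {n = zero}  h = refl
  ∑-tabulate {n = suc n} h {f} = cong (f (h zero) +_)
    (trans (∑-tabulate (h ∘ suc)) (sym (∑-tabulate {A = Fin (suc n)} suc {f ∘ h})))

  module _ {A : Set} {P : A → Set} (P? : Decidable P) where

    ∑-filter : ∀ xs {f} → ∑ (filter P? xs) f ≡ ∑[ x ← xs ] (𝟙 (P? x) * f x)
    ∑-filter []           = refl
    ∑-filter (x ∷ xs) {f} with P? x
    ... | yes _ = cong₂ _+_ (sym (+-identityʳ (f x))) (∑-filter xs)
    ... | no  _ = ∑-filter xs

    length-filter-∑ : ∀ xs → length (filter P? xs) ≡ ∑[ x ← xs ] 𝟙 (P? x)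
    length-filter-∑ []       = refl
    length-filter-∑ (x ∷ xs) with P? x
    ... | yes _ = cong suc (length-filter-∑ xs)
    ... | no  _ = length-filter-∑ xs

    ∑-partition : ∀ xs {f} →
                  ∑ xs f ≡ ∑ (filter (¬? ∘ P?) xs) f + ∑ (filter P? xs) f
    ∑-partition []           = refl
    ∑-partition (x ∷ xs) {f} with P? x
    ... | yes _ = trans (cong (f x +_) (∑-partition xs))
        (swap (f x) (∑ (filter (¬? ∘ P?) xs) f) (∑ (filter P? xs) f))
      where
      swap : ∀ a b c → a + (b + c) ≡ b + (a + c)
      swap = solve-∀
    ... | no  _ = trans (cong (f x +_) (∑-partition xs)) (sym (+-assoc (f x) _ _))

  length-∑ : ∀ (xs : List A) → length xs ≡ ∑[ _ ← xs ] 1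
  length-∑ xs = sym (trans (∑-const xs 1) (*-identityʳ (length xs)))

  -- A list without repetitions whose entries all occur in another list is not
  -- longer than that list.
  unique⇒length≤ : ∀ {xs ys : List A} → Unique xs → (∀ {x} → x ∈ xs → x ∈ ys) →
                   length xs ≤ length ys
  unique⇒length≤ []                        _     = z≤n
  unique⇒length≤ {xs = x ∷ xs} (x∉xs ∷ xs!) xs⊆ys with ∈-∃++ (xs⊆ys (here refl))
  ... | as , bs , refl = ≤-trans (s≤s (unique⇒length≤ xs! xs⊆as++bs))
                                 (≤-reflexive (sym (length-insert as)))
    where
    length-insert : ∀ as → length (as ++ x ∷ bs) ≡ suc (length (as ++ bs))
    length-insert []       = refl
    length-insert (_ ∷ as) = cong suc (length-insert as)

    xs⊆as++bs : ∀ {y} → y ∈ xs → y ∈ as ++ bs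
    xs⊆as++bs y∈xs with ∈-++⁻ as (xs⊆ys (there y∈xs))
    ... | inj₁ y∈as           = ∈-++⁺ˡ y∈as
    ... | inj₂ (here refl)    = contradiction refl (All.lookup x∉xs y∈xs)
    ... | inj₂ (there y∈bs)   = ∈-++⁺ʳ as y∈bs

  map-unique : ∀ {xs : List A} {f : A → B} →
               (∀ {x y} → x ∈ xs → y ∈ xs → f x ≡ f y → x ≡ y) →
               Unique xs → Unique (map f xs)
  map-unique inj []                           = []
  map-unique {xs = x ∷ xs} {f} inj (x∉xs ∷ xs!) =
    All.tabulate (λ fy∈ → fx≢ (∈-map⁻ f fy∈))
    ∷ map-unique (λ x∈ y∈ → inj (there x∈) (there y∈)) xs!
    where
    fx≢ : ∀ {z} → ∃ (λ y → y ∈ xs × z ≡ f y) → f x ≢ z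
    fx≢ (_ , y∈xs , refl) eq =
      All.lookup x∉xs y∈xs (inj (here refl) (there y∈xs) eq)

  -- A sum against the indicator of equality with one entry picks out the value
  -- at that entry.
  ∑-point : ∀ {xs : List A} {a} (a? : ∀ x → Dec (x ≡ a)) → Unique xs → a ∈ xs →
            ∀ {f : A → ℕ} → ∑[ x ← xs ] (𝟙 (a? x) * f x) ≡ f a
  ∑-point {xs = x ∷ xs} a? (x∉xs ∷ xs!) (here refl) {f} = begin
    𝟙 (a? x) * f x + rest  ≡⟨ cong₂ _+_ (cong (_* f x) (𝟙-yes (a? x) refl))
                                (∑-zero xs λ {y} y∈ → cong (_* f y)
                                  (𝟙-no (a? y) λ { refl → All.lookup x∉xs y∈ refl })) ⟩
    1 * f x + 0            ≡⟨ +-identityʳ (1 * f x) ⟩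
    1 * f x                ≡⟨ *-identityˡ (f x) ⟩
    f x                    ∎
    where
    open ≡-Reasoning
    rest = ∑[ y ← xs ] (𝟙 (a? y) * f y)
  ∑-point {xs = x ∷ xs} a? (x∉xs ∷ xs!) (there a∈) {f} = cong₂ _+_
    (cong (_* f x) (𝟙-no (a? x) λ { refl → All.lookup x∉xs a∈ refl }))
    (∑-point a? xs! a∈)

  ∑-point-1 : ∀ {xs : List A} {a} (a? : ∀ x → Dec (x ≡ a)) → Unique xs → a ∈ xs →
              ∑[ x ← xs ] 𝟙 (a? x) ≡ 1
  ∑-point-1 {xs = xs} a? xs! a∈ =
    trans (∑-cong xs λ {x} _ → sym (*-identityʳ (𝟙 (a? x))))
          (∑-point a? xs! a∈ {λ _ → 1})

  ∑-allFin-point : ∀ {n} (a : Fin n) {f : Fin n → ℕ} →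
                   ∑[ x ← allFin n ] (𝟙 (x Fin.≟ a) * f x) ≡ f a
  ∑-allFin-point {n} a = ∑-point (Fin._≟ a) (Unique.allFin⁺ n) (∈-allFin a)

-- Subsets of a finite set

module Subsets where

  open Sums
  open import Data.Bool using (true; false)
  open import Data.Empty using (⊥-elim)
  open import Data.Fin using (Fin; suc)
  import Data.Fin.Properties as Finₚ
  open import Data.Fin.Subset
  open import Data.Fin.Subset.Properties
  open import Data.List using (List; []; _∷_; length; filter; allFin)
  open import Data.List.Membership.Propositional using () renaming (_∈_ to _∈ˡ_)
  open import Data.List.Membership.Propositional.Properties
    using (∈-filter⁺; ∈-filter⁻; ∈-allFin)
  open import Data.Nat using (ℕ; suc; _*_; _≤_; _<_)
  open import Data.Nat.Properties
  open import Data.Product using (∃; _×_; _,_; proj₁; proj₂)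
  open import Data.Vec using ([]; _∷_)
  open import Function using (_∘_)
  open import Relation.Binary.PropositionalEquality
  open import Relation.Nullary using (Dec; yes; no; ¬_; contradiction)
  open import Relation.Nullary.Decidable using (¬?; _×-dec_)

  private variable
    n : ℕ
    F G : Subset n

  ∣_∣-∑ : (S : Subset n) → ∣ S ∣ ≡ ∑[ x ← allFin n ] 𝟙 (x ∈? S)
  ∣_∣-∑         []          = refl
  ∣_∣-∑ {suc n} (true ∷ S)  = cong suc (trans ∣ S ∣-∑ (sym (∑-tabulate (Fin.suc {n}))))
  ∣_∣-∑ {suc n} (false ∷ S) = trans ∣ S ∣-∑ (sym (∑-tabulate (Fin.suc {n})))

  -- The members of a set in increasing order.
  elements : Subset n → List (Fin n)
  elements {n} S = filter (_∈? S) (allFin n)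

  length-elements : (S : Subset n) → length (elements S) ≡ ∣ S ∣
  length-elements {n} S =
    trans (length-filter-∑ (_∈? S) (allFin n)) (sym ∣ S ∣-∑)

  ∈-elements : ∀ {x} → x ∈ F → x ∈ˡ elements F
  ∈-elements {F = F} {x} x∈F = ∈-filter⁺ (_∈? F) (∈-allFin x) x∈F

  elements-∈ : ∀ {x} → x ∈ˡ elements F → x ∈ F
  elements-∈ {F = F} x∈ = proj₂ (∈-filter⁻ (_∈? F) {xs = allFin _} x∈)

  𝟙-∩ : ∀ (F G : Subset n) x → 𝟙 (x ∈? F ∩ G) ≡ 𝟙 (x ∈? F) * 𝟙 (x ∈? G)
  𝟙-∩ F G x with x ∈? F | x ∈? G
  ... | yes p | yes q = 𝟙-yes (x ∈? F ∩ G) (x∈p∩q⁺ (p , q))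
  ... | yes p | no ¬q = 𝟙-no (x ∈? F ∩ G) (¬q ∘ proj₂ ∘ x∈p∩q⁻ F G)
  ... | no ¬p | _     = 𝟙-no (x ∈? F ∩ G) (¬p ∘ proj₁ ∘ x∈p∩q⁻ F G)

  x∈F⇒⁅x⁆⊆F : ∀ {x} → x ∈ F → ⁅ x ⁆ ⊆ F
  x∈F⇒⁅x⁆⊆F {F = F} {x} x∈F y∈ = subst (_∈ F) (sym (x∈⁅y⁆⇒x≡y x y∈)) x∈F

  nonempty⇒∣∣>0 : Nonempty F → 0 < ∣ F ∣
  nonempty⇒∣∣>0 {F = F} (x , x∈F) =
    subst (_≤ ∣ F ∣) (∣⁅x⁆∣≡1 x) (p⊆q⇒∣p∣≤∣q∣ (x∈F⇒⁅x⁆⊆F x∈F))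

  ∣∣>0⇒nonempty : 0 < ∣ F ∣ → Nonempty F
  ∣∣>0⇒nonempty {n} {F} 0<∣F∣ with nonempty? F
  ... | yes ne = ne
  ... | no ¬ne = contradiction
    (trans (cong ∣_∣ (Empty-unique ¬ne)) (∣⊥∣≡0 n)) (>⇒≢ 0<∣F∣)

  ⊈⇒∃∉ : ¬ (F ⊆ G) → ∃ λ x → x ∈ F × ¬ (x ∈ G)
  ⊈⇒∃∉ {F = F} {G} F⊈G with Finₚ.any? (λ x → (x ∈? F) ×-dec ¬? (x ∈? G))
  ... | yes w = w
  ... | no ¬w = ⊥-elim (F⊈G F⊆G)
    where
    F⊆G : F ⊆ G
    F⊆G {x} x∈F with x ∈? G
    ... | yes x∈G = x∈G
    ... | no  x∉G = contradiction (x , x∈F , x∉G) ¬w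

  ⊆∧⊉⇒∣∣< : F ⊆ G → ¬ (G ⊆ F) → ∣ F ∣ < ∣ G ∣
  ⊆∧⊉⇒∣∣< F⊆G G⊈F = p⊂q⇒∣p∣<∣q∣ (F⊆G , ⊈⇒∃∉ G⊈F)

  ⊆∧∣∣≥⇒≡ : F ⊆ G → ∣ G ∣ ≤ ∣ F ∣ → F ≡ G
  ⊆∧∣∣≥⇒≡ {F = F} {G} F⊆G ∣G∣≤∣F∣ with G ⊆? F
  ... | yes G⊆F = ⊆-antisym F⊆G G⊆F
  ... | no  G⊈F = contradiction ∣G∣≤∣F∣ (<⇒≱ (⊆∧⊉⇒∣∣< F⊆G G⊈F))

  -- Two sets meet if they are not disjoint.
  meets? : (F G : Subset n) → Dec (∣ F ∩ G ∣ ≢ 0)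
  meets? F G = ¬? (∣ F ∩ G ∣ ≟ 0)

  common⇒meets : ∀ {x} → x ∈ F → x ∈ G → ∣ F ∩ G ∣ ≢ 0
  common⇒meets x∈F x∈G =
    >⇒≢ (nonempty⇒∣∣>0 (_ , x∈p∩q⁺ (x∈F , x∈G)))

  meets⇒common : ∀ (F G : Subset n) → ∣ F ∩ G ∣ ≢ 0 → ∃ λ x → x ∈ F × x ∈ G
  meets⇒common F G ≢0 with ∣∣>0⇒nonempty (n≢0⇒n>0 ≢0)
  ... | x , x∈F∩G = x , x∈p∩q⁻ F G x∈F∩G

  meets-mono : ∀ {F F′ G G′ : Subset n} → F ⊆ F′ → G ⊆ G′ →
               ∣ F ∩ G ∣ ≢ 0 → ∣ F′ ∩ G′ ∣ ≢ 0
  meets-mono {F = F} {G = G} F⊆F′ G⊆G′ m with meets⇒common F G m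
  ... | x , x∈F , x∈G = common⇒meets (F⊆F′ x∈F) (G⊆G′ x∈G)

  ⁅⁆-injective : ∀ {x y : Fin n} → ⁅ x ⁆ ≡ ⁅ y ⁆ → x ≡ y
  ⁅⁆-injective {x = x} {y} eq = x∈⁅y⁆⇒x≡y y (subst (x ∈_) eq (x∈⁅x⁆ x))

  ∣∣≡1⇒⁅⁆ : ∀ {F : Subset n} → Nonempty F → ∣ F ∣ ≤ 1 → ∃ λ x → F ≡ ⁅ x ⁆
  ∣∣≡1⇒⁅⁆ (x , x∈F) ≤1 =
    x , sym (⊆∧∣∣≥⇒≡ (x∈F⇒⁅x⁆⊆F x∈F) (subst (_ ≤_) (sym (∣⁅x⁆∣≡1 x)) ≤1))

-- The upper bound for the members with at least two elements

module LargeMembers where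

  open Sums
  open Subsets
  open import Data.Empty using (⊥-elim)
  open import Data.Fin using (Fin)
  open import Data.Fin.Subset
  open import Data.Fin.Subset.Properties
  open import Data.List using (List; []; _∷_; map; length; filter; allFin)
  open import Data.List.Membership.Propositional using () renaming (_∈_ to _∈ˡ_)
  open import Data.List.Membership.Propositional.Properties using (∈-filter⁻; ∈-map⁺)
  open import Data.List.Properties using (length-map; length-tabulate)
  open import Data.List.Relation.Unary.Any using (here; there)
  open import Data.List.Relation.Unary.Unique.Propositional using (Unique)
  import Data.List.Relation.Unary.Unique.Propositional.Properties as Unique
  open import Data.Nat
    using (ℕ; suc; _+_; _*_; _^_; _/_; _≤_; _<_; _≤?_; z≤n; s≤s; s≤s⁻¹; pred; >-nonZero)
  open import Data.Nat.DivMod using (/-monoˡ-≤; m*n/n≡m)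
  open import Data.Nat.Properties
  open import Data.Nat.Tactic.RingSolver using (solve-∀)
  open import Data.Product using (∃; _×_; _,_; proj₂)
  open import Data.Sum using (inj₁; inj₂)
  open import Function using (id)
  open import Relation.Binary.PropositionalEquality
  open import Relation.Nullary using (Dec; yes; no; ¬_)
  open import Relation.Nullary.Decidable using (_×-dec_; decidable-stable)

  -- For integers, a (k - a) is at most k² / 4, hence at most its integer part.
  k*a≤⌊k²/4⌋+a² : ∀ k a → k * a ≤ k ^ 2 / 4 + a * a
  k*a≤⌊k²/4⌋+a² k a with ≤-total k a
  ... | inj₁ k≤a = ≤-trans (*-monoˡ-≤ a k≤a) (m≤n+m (a * a) (k ^ 2 / 4))
  ... | inj₂ a≤k with m≤n⇒∃[o]m+o≡n a≤k
  ...   | b , refl = begin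
    (a + b) * a                  ≡⟨ expand a b ⟩
    a * b + a * a                ≤⟨ +-monoˡ-≤ (a * a) ab≤ ⟩
    (a + b) ^ 2 / 4 + a * a      ∎
    where
    open ≤-Reasoning
    expand : ∀ a b → (a + b) * a ≡ a * b + a * a
    expand = solve-∀

    square-gap : ∀ a c → a * (a + c) * 4 + c * c ≡ (a + (a + c)) * ((a + (a + c)) * 1)
    square-gap = solve-∀

    4ab≤ : ∀ {a b} → a ≤ b → a * b * 4 ≤ (a + b) ^ 2
    4ab≤ {a} a≤b with m≤n⇒∃[o]m+o≡n a≤b
    ... | c , refl =
      subst (a * (a + c) * 4 ≤_) (square-gap a c) (m≤m+n (a * (a + c) * 4) (c * c))

    4ab≤′ : a * b * 4 ≤ (a + b) ^ 2
    4ab≤′ with ≤-total a b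
    ... | inj₁ a≤b = 4ab≤ a≤b
    ... | inj₂ b≤a =
      subst₂ _≤_ (cong (_* 4) (*-comm b a)) (cong (_^ 2) (+-comm b a)) (4ab≤ b≤a)

    ab≤ : a * b ≤ (a + b) ^ 2 / 4
    ab≤ = subst (_≤ (a + b) ^ 2 / 4) (m*n/n≡m (a * b) 4) (/-monoˡ-≤ 4 4ab≤′)

  -- The set G is F, or F with one element removed.
  near? : ∀ {n} (F G : Subset n) → Dec (G ⊆ F × ∣ F ∣ ≤ suc ∣ G ∣)
  near? F G = (G ⊆? F) ×-dec (∣ F ∣ ≤? suc ∣ G ∣)

  -- For meeting sets ∣ F ∩ G ∣ ≤ ∣ F ∣ - 1 unless F ⊆ G.  If G ⊊ F, the
  -- intersection has size ∣ G ∣, which is at most ∣ F ∣ - 2 unless G is F with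
  -- one element removed.
  intersection-bound : ∀ {n} (F G : Subset n) → 0 < ∣ F ∣ → 0 < ∣ G ∣ →
    ∣ F ∩ G ∣ + 𝟙 (G ⊆? F) ≤
    pred ∣ F ∣ * 𝟙 (meets? F G) + (𝟙 (F ⊆? G) + 𝟙 (near? F G))
  intersection-bound F G 0<∣F∣ 0<∣G∣ =
    compare (meets? F G) (F ⊆? G) (G ⊆? F) (near? F G)
    where
    open ≤-Reasoning
    r = pred ∣ F ∣

    ∣F∣≡1+r : ∣ F ∣ ≡ suc r
    ∣F∣≡1+r = sym (suc-pred ∣ F ∣ ⦃ >-nonZero 0<∣F∣ ⦄)

    ∣F∩G∣≤r : ¬ (F ⊆ G) → ∣ F ∩ G ∣ ≤ r
    ∣F∩G∣≤r F⊈G = s≤s⁻¹ (subst (∣ F ∩ G ∣ <_) ∣F∣≡1+r (⊆∧⊉⇒∣∣< (p∩q⊆p F G)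
      λ F⊆F∩G → F⊈G λ x∈F → proj₂ (x∈p∩q⁻ F G (F⊆F∩G x∈F))))

    ∣F∩G∣≤1+r : ∣ F ∩ G ∣ ≤ suc r
    ∣F∩G∣≤1+r = subst (∣ F ∩ G ∣ ≤_) ∣F∣≡1+r (∣p∩q∣≤∣p∣ F G)

    G⊆F⇒meet : G ⊆ F → ∣ F ∩ G ∣ ≢ 0
    G⊆F⇒meet G⊆F with ∣∣>0⇒nonempty 0<∣G∣
    ... | x , x∈G = common⇒meets (G⊆F x∈G) x∈G

    meeting : (F⊆G? : Dec (F ⊆ G)) (G⊆F? : Dec (G ⊆ F))
              (nr? : Dec (G ⊆ F × ∣ F ∣ ≤ suc ∣ G ∣)) →
              ∣ F ∩ G ∣ + 𝟙 G⊆F? ≤ r + (𝟙 F⊆G? + 𝟙 nr?)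
    meeting (yes F⊆G) (yes G⊆F) (yes _) = begin
      ∣ F ∩ G ∣ + 1  ≤⟨ +-monoˡ-≤ 1 ∣F∩G∣≤1+r ⟩
      suc r + 1      ≡⟨ sym (+-suc r 1) ⟩
      r + 2          ∎
    meeting (yes F⊆G) (yes G⊆F) (no ¬near) =
      ⊥-elim (¬near (G⊆F , m≤n⇒m≤1+n (p⊆q⇒∣p∣≤∣q∣ F⊆G)))
    meeting (yes _) (no _) nr? = begin
      ∣ F ∩ G ∣ + 0     ≡⟨ +-identityʳ ∣ F ∩ G ∣ ⟩
      ∣ F ∩ G ∣         ≤⟨ ∣F∩G∣≤1+r ⟩
      suc r             ≤⟨ s≤s (m≤m+n r (𝟙 nr?)) ⟩
      suc (r + 𝟙 nr?)   ≡⟨ sym (+-suc r (𝟙 nr?)) ⟩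
      r + suc (𝟙 nr?)   ∎
    meeting (no F⊈G) (yes _) (yes _) = +-monoˡ-≤ 1 (∣F∩G∣≤r F⊈G)
    meeting (no F⊈G) (yes G⊆F) (no ¬near) = begin
      ∣ F ∩ G ∣ + 1  ≤⟨ +-monoˡ-≤ 1 (∣p∩q∣≤∣q∣ F G) ⟩
      ∣ G ∣ + 1      ≡⟨ +-comm ∣ G ∣ 1 ⟩
      suc ∣ G ∣      ≤⟨ 1+∣G∣≤r ⟩
      r              ≡⟨ sym (+-identityʳ r) ⟩
      r + 0          ∎
      where
      1+∣G∣≤r : suc ∣ G ∣ ≤ r
      1+∣G∣≤r = s≤s⁻¹ (subst (suc ∣ G ∣ <_) ∣F∣≡1+r
        (≰⇒> λ ∣F∣≤1+∣G∣ → ¬near (G⊆F , ∣F∣≤1+∣G∣)))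
    meeting (no F⊈G) (no _) nr? = +-mono-≤ (∣F∩G∣≤r F⊈G) z≤n

    compare : (m? : Dec (∣ F ∩ G ∣ ≢ 0))
              (F⊆G? : Dec (F ⊆ G)) (G⊆F? : Dec (G ⊆ F))
              (nr? : Dec (G ⊆ F × ∣ F ∣ ≤ suc ∣ G ∣)) →
              ∣ F ∩ G ∣ + 𝟙 G⊆F? ≤ r * 𝟙 m? + (𝟙 F⊆G? + 𝟙 nr?)
    compare (yes _) F⊆G? G⊆F? nr? =
      subst (λ m → ∣ F ∩ G ∣ + 𝟙 G⊆F? ≤ m + (𝟙 F⊆G? + 𝟙 nr?))
        (sym (*-identityʳ r)) (meeting F⊆G? G⊆F? nr?)
    compare (no ¬meet) F⊆G? G⊆F? nr? = ≤-trans (≤-reflexive (cong₂ _+_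
      (decidable-stable (∣ F ∩ G ∣ ≟ 0) ¬meet)
      (𝟙-no G⊆F? λ G⊆F → ¬meet (G⊆F⇒meet G⊆F)))) z≤n

  near⇒listed : ∀ {n} {F G : Subset n} → G ⊆ F × ∣ F ∣ ≤ suc ∣ G ∣ →
           G ∈ˡ F ∷ map (F -_) (elements F)
  near⇒listed {F = F} {G} (G⊆F , ∣F∣≤) with F ⊆? G
  ... | yes F⊆G = here (⊆-antisym G⊆F F⊆G)
  ... | no  F⊈G with ⊈⇒∃∉ F⊈G
  ...   | x , x∈F , x∉G = there (subst (_∈ˡ map (F -_) (elements F)) (sym G≡F-x)
                            (∈-map⁺ (F -_) (∈-elements x∈F)))
    where
    G≡F-x : G ≡ F - x
    G≡F-x = ⊆∧∣∣≥⇒≡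
      (λ y∈G → x∈p∧x≢y⇒x∈p-y (G⊆F y∈G) λ { refl → x∉G y∈G })
      (s≤s⁻¹ (≤-trans (x∈p⇒∣p-x∣<∣p∣ x∈F) ∣F∣≤))

  -- At most 1 + ∣ F ∣ sets are near F, which suffices for ∣ F ∣ ≥ 3.  For
  -- ∣ F ∣ = 2 the removal of an element leaves a singleton, so only F itself counts.
  count-near : ∀ {n} {B : List (Subset n)} {F} → Unique B →
               (∀ {G} → G ∈ˡ B → 1 < ∣ G ∣) → 1 < ∣ F ∣ →
               ∑[ G ← B ] 𝟙 (near? F G) ≤ pred ∣ F ∣ * pred ∣ F ∣
  count-near {B = B} {F} B! large 1<∣F∣ =
    subst (_≤ pred ∣ F ∣ * pred ∣ F ∣) (length-filter-∑ (near? F) B) bound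
    where
    open ≤-Reasoning

    nears! : Unique (filter (near? F) B)
    nears! = Unique.filter⁺ (near? F) B!

    1+∣F∣≤ : 2 < ∣ F ∣ → suc ∣ F ∣ ≤ pred ∣ F ∣ * pred ∣ F ∣
    1+∣F∣≤ 2<∣F∣ with m≤n⇒∃[o]m+o≡n 2<∣F∣
    ... | t , eq = subst (λ s → suc s ≤ pred s * pred s) eq
      (subst (4 + t ≤_) (square t) (m≤m+n (4 + t) (t * (3 + t))))
      where
      square : ∀ t → 4 + t + t * (3 + t) ≡ (2 + t) * (2 + t)
      square = solve-∀

    bound : length (filter (near? F) B) ≤ pred ∣ F ∣ * pred ∣ F ∣
    bound with m≤n⇒m<n∨m≡n 1<∣F∣
    ... | inj₁ 2<∣F∣ = begin
      length (filter (near? F) B)             ≤⟨ unique⇒length≤ nears! among ⟩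
      suc (length (map (F -_) (elements F)))  ≡⟨ cong suc (length-map (F -_) (elements F)) ⟩
      suc (length (elements F))               ≡⟨ cong suc (length-elements F) ⟩
      suc ∣ F ∣                               ≤⟨ 1+∣F∣≤ 2<∣F∣ ⟩
      pred ∣ F ∣ * pred ∣ F ∣                 ∎
      where
      among : ∀ {G} → G ∈ˡ filter (near? F) B → G ∈ˡ F ∷ map (F -_) (elements F)
      among G∈ = near⇒listed (proj₂ (∈-filter⁻ (near? F) {xs = B} G∈))
    ... | inj₂ 2≡∣F∣ = begin
      length (filter (near? F) B)  ≤⟨ unique⇒length≤ nears! only-F ⟩
      length (F ∷ [])              ≡⟨ cong (λ s → pred s * pred s) 2≡∣F∣ ⟩
      pred ∣ F ∣ * pred ∣ F ∣      ∎
      where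
      only-F : ∀ {G} → G ∈ˡ filter (near? F) B → G ∈ˡ F ∷ []
      only-F G∈ with ∈-filter⁻ (near? F) {xs = B} G∈
      ... | G∈B , G⊆F , _ =
        here (⊆∧∣∣≥⇒≡ G⊆F (subst (_≤ _) 2≡∣F∣ (large G∈B)))

  -- The number of listed sets that contain x.
  degree : ∀ {n} → List (Subset n) → Fin n → ℕ
  degree B x = ∑[ F ← B ] 𝟙 (x ∈? F)

  ∑-degree : ∀ {n} (B : List (Subset n)) →
             ∑[ x ← allFin n ] degree B x ≡ ∑[ F ← B ] ∣ F ∣
  ∑-degree {n} B = trans (∑-swap (allFin n) B) (∑-cong B λ {F} _ → sym ∣ F ∣-∑)

  ∑-degree² : ∀ {n} (B : List (Subset n)) →
              ∑[ x ← allFin n ] (degree B x * degree B x) ≡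
              ∑[ F ← B ] ∑[ G ← B ] ∣ F ∩ G ∣
  ∑-degree² {n} B = begin
    ∑[ x ← V ] (degree B x * degree B x)
      ≡⟨ ∑-cong V (λ {x} _ → sym (∑-*ʳ B (degree B x))) ⟩
    ∑[ x ← V ] ∑[ F ← B ] (𝟙 (x ∈? F) * degree B x)
      ≡⟨ ∑-cong V (λ {x} _ → ∑-cong B λ {F} _ → sym (∑-*ˡ B (𝟙 (x ∈? F)))) ⟩
    ∑[ x ← V ] ∑[ F ← B ] ∑[ G ← B ] (𝟙 (x ∈? F) * 𝟙 (x ∈? G))
      ≡⟨ ∑-swap V B ⟩
    ∑[ F ← B ] ∑[ x ← V ] ∑[ G ← B ] (𝟙 (x ∈? F) * 𝟙 (x ∈? G))
      ≡⟨ ∑-cong B (λ _ → ∑-swap V B) ⟩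
    ∑[ F ← B ] ∑[ G ← B ] ∑[ x ← V ] (𝟙 (x ∈? F) * 𝟙 (x ∈? G))
      ≡⟨ ∑-cong B (λ {F} _ → ∑-cong B λ {G} _ →
           trans (∑-cong V λ {x} _ → sym (𝟙-∩ F G x)) (sym ∣ F ∩ G ∣-∑)) ⟩
    ∑[ F ← B ] ∑[ G ← B ] ∣ F ∩ G ∣ ∎
    where
    open ≡-Reasoning
    V = allFin n

  -- The upper bound for the members with at least two elements, given that each
  -- of them meets, counting itself, at most k + 1 - ∣ F ∣ of them.
  large-members : ∀ {n} k {B : List (Subset n)} → Unique B →
    (∀ {F} → F ∈ˡ B → 1 < ∣ F ∣) →
    (∀ {F} → F ∈ˡ B → ∑[ G ← B ] 𝟙 (meets? F G) + ∣ F ∣ ≤ suc k) →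
    k * length B ≤ n * (k ^ 2 / 4)
  large-members {n} k {B} B! large few = +-cancelʳ-≤ X (k * length B) (n * q) (begin
    k * length B + X                ≤⟨ +-monoʳ-≤ (k * length B) X≤ ⟩
    k * length B + Y                ≡⟨ cong (_+ Y) (*-comm k (length B)) ⟩
    length B * k + Y                ≡⟨ cong (_+ Y) (sym (∑-const B k)) ⟩
    ∑[ F ← B ] k + Y                ≡⟨ sym (∑-+ B) ⟩
    ∑[ F ← B ] (k + k * pred ∣ F ∣) ≡⟨ ∑-cong B (λ F∈B → sym (k*∣F∣ F∈B)) ⟩
    ∑[ F ← B ] (k * ∣ F ∣)          ≡⟨ ∑-*ˡ B k ⟩
    k * ∑[ F ← B ] ∣ F ∣            ≡⟨ cong (k *_) (sym (∑-degree B)) ⟩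
    k * ∑ V (degree B)              ≡⟨ sym (∑-*ˡ V k) ⟩
    ∑[ x ← V ] (k * degree B x)     ≤⟨ ∑-mono V (λ {x} _ → k*a≤⌊k²/4⌋+a² k (degree B x)) ⟩
    ∑[ x ← V ] (q + degree B x * degree B x)
                                    ≡⟨ ∑-+ V ⟩
    ∑[ x ← V ] q + ∑[ x ← V ] (degree B x * degree B x)
                                    ≡⟨ cong₂ _+_ (∑-const V q) (∑-degree² B) ⟩
    length V * q + X                ≡⟨ cong (λ l → l * q + X) (length-tabulate {n = n} id) ⟩
    n * q + X                       ∎)
    where
    open ≤-Reasoning
    V = allFin n
    q = k ^ 2 / 4
    X = ∑[ F ← B ] ∑[ G ← B ] ∣ F ∩ G ∣
    Y = ∑[ F ← B ] (k * pred ∣ F ∣)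

    -- The number of members of B that F meets, F itself included.
    N : Subset n → ℕ
    N F = ∑[ G ← B ] 𝟙 (meets? F G)

    k*∣F∣ : ∀ {F} → F ∈ˡ B → k * ∣ F ∣ ≡ k + k * pred ∣ F ∣
    k*∣F∣ {F} F∈B with ∣ F ∣ | large F∈B
    ... | suc r | _ = *-suc k r

    -- Summing over all pairs, the indicators of containment cancel.
    X≤ : X ≤ Y
    X≤ = +-cancelʳ-≤ C X Y (begin
      X + C
        ≡⟨ trans (sym (∑-+ B)) (∑-cong B λ _ → sym (∑-+ B)) ⟩
      ∑[ F ← B ] ∑[ G ← B ] (∣ F ∩ G ∣ + 𝟙 (G ⊆? F))
        ≤⟨ ∑-mono B (λ {F} F∈ → ∑-mono B λ {G} G∈ → intersection-bound F G
             (<-trans (n<1+n 0) (large F∈)) (<-trans (n<1+n 0) (large G∈))) ⟩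
      ∑[ F ← B ] ∑[ G ← B ] (pred ∣ F ∣ * 𝟙 (meets? F G) + (𝟙 (F ⊆? G) + 𝟙 (near? F G)))
        ≡⟨ ∑-cong B (λ {F} _ → trans (∑-+ B) (cong₂ _+_ (∑-*ˡ B (pred ∣ F ∣)) (∑-+ B))) ⟩
      ∑[ F ← B ] (pred ∣ F ∣ * N F + (∑[ G ← B ] 𝟙 (F ⊆? G) + ∑[ G ← B ] 𝟙 (near? F G)))
        ≤⟨ ∑-mono B (λ F∈ → per-member F∈) ⟩
      ∑[ F ← B ] (k * pred ∣ F ∣ + ∑[ G ← B ] 𝟙 (F ⊆? G))
        ≡⟨ ∑-+ B ⟩
      Y + ∑[ F ← B ] ∑[ G ← B ] 𝟙 (F ⊆? G)
        ≡⟨ cong (Y +_) (∑-swap B B) ⟩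
      Y + C ∎)
      where
      C = ∑[ F ← B ] ∑[ G ← B ] 𝟙 (G ⊆? F)

      rearrange : ∀ r N s d → r * N + (s + d) ≡ r * N + d + s
      rearrange = solve-∀

      factor : ∀ r N → r * N + r * r ≡ (N + r) * r
      factor = solve-∀

      N+r≤k : ∀ {F} → F ∈ˡ B → N F + pred ∣ F ∣ ≤ k
      N+r≤k {F} F∈ with ∣ F ∣ | large F∈ | few F∈
      ... | suc r | _ | le = s≤s⁻¹ (subst (_≤ suc k) (+-suc (N F) r) le)

      per-member : ∀ {F} → F ∈ˡ B →
        pred ∣ F ∣ * N F + (∑[ G ← B ] 𝟙 (F ⊆? G) + ∑[ G ← B ] 𝟙 (near? F G)) ≤
        k * pred ∣ F ∣ + ∑[ G ← B ] 𝟙 (F ⊆? G)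
      per-member {F} F∈ = begin
        r * N F + (S + D)      ≡⟨ rearrange r (N F) S D ⟩
        r * N F + D + S        ≤⟨ +-monoˡ-≤ S (+-monoʳ-≤ (r * N F)
                                    (count-near B! large (large F∈))) ⟩
        r * N F + r * r + S    ≡⟨ cong (_+ S) (factor r (N F)) ⟩
        (N F + r) * r + S      ≤⟨ +-monoˡ-≤ S (*-monoˡ-≤ r (N+r≤k F∈)) ⟩
        k * r + S              ∎
        where
        r = pred ∣ F ∣
        S = ∑[ G ← B ] 𝟙 (F ⊆? G)
        D = ∑[ G ← B ] 𝟙 (near? F G)

-- The upper bound for all families

module UpperBound where

  open Sums
  open Subsets
  open LargeMembers
  open import Defs
  open import Data.Empty using (⊥-elim)
  open import Data.Fin using (Fin)
  open import Data.Fin.Subset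
  open import Data.Fin.Subset.Properties
  open import Data.List using (List; []; _∷_; map; length; filter; allFin)
  open import Data.List.Membership.Propositional using (find) renaming (_∈_ to _∈ˡ_)
  open import Data.List.Membership.Propositional.Properties
    using (∈-filter⁺; ∈-filter⁻; ∈-map⁺; ∈-map⁻; ∈-allFin)
  open import Data.List.Properties using (length-map; length-tabulate)
  import Data.List.Relation.Unary.All as All
  open import Data.List.Relation.Unary.Any as Any using (here; there; any?)
  open import Data.List.Relation.Unary.Unique.Propositional using (Unique)
  import Data.List.Relation.Unary.Unique.Propositional.Properties as Unique
  open import Data.Nat using (ℕ; suc; _+_; _*_; _^_; _/_; _≤_; _<_; _<?_; s≤s)
  open import Data.Nat.Properties
  open import Data.Product using (∃; _×_; _,_; proj₁; proj₂)
  open import Data.Sum using (_⊎_; inj₁; inj₂)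
  open import Function using (_∘_; id)
  open import Relation.Binary.PropositionalEquality
  open import Relation.Nullary using (Dec; yes; no; ¬_; contradiction)
  open import Relation.Nullary.Decidable using (¬?; _×-dec_)

  -- A repetition-free list of nonempty sets each of which meets at most k of the
  -- others.
  record Sparse {n} (k : ℕ) (L : List (Subset n)) : Set where
    field
      unique   : Unique L
      nonempty : ∀ {F} → F ∈ˡ L → Nonempty F
      -- The bound is k + 1 because F, being nonempty, meets itself.
      few      : ∀ {F} → F ∈ˡ L → ∑[ G ← L ] 𝟙 (meets? F G) ≤ suc k

  open Sparse

  -- If x is covered at all, the singleton of x is listed.
  Closed : ∀ {n} → List (Subset n) → Fin n → Set
  Closed L x = ∀ {F} → F ∈ˡ L → x ∈ F → ⁅ x ⁆ ∈ˡ L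

  -- The member F₀ through x is replaced by the singleton of x, which is not listed.
  -- This can only destroy intersections.
  module Shrink {n k : ℕ} {L : List (Subset n)} (sparse : Sparse k L)
                {x : Fin n} {F₀ : Subset n} (F₀∈L : F₀ ∈ˡ L) (x∈F₀ : x ∈ F₀)
                (⁅x⁆∉L : ¬ (⁅ x ⁆ ∈ˡ L)) where

    shrink : Subset n → Subset n
    shrink G with G ≟ˢ F₀
    ... | yes _ = ⁅ x ⁆
    ... | no  _ = G

    shrink-⊆ : ∀ G → shrink G ⊆ G
    shrink-⊆ G with G ≟ˢ F₀
    ... | yes refl = x∈F⇒⁅x⁆⊆F x∈F₀
    ... | no _     = id

    shrink-F₀ : shrink F₀ ≡ ⁅ x ⁆
    shrink-F₀ with F₀ ≟ˢ F₀
    ... | yes _ = refl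
    ... | no ≢  = contradiction refl ≢

    shrink-other : ∀ {G} → G ≢ F₀ → shrink G ≡ G
    shrink-other {G} G≢F₀ with G ≟ˢ F₀
    ... | yes G≡F₀ = contradiction G≡F₀ G≢F₀
    ... | no _     = refl

    shrink-nonempty : ∀ {G} → Nonempty G → Nonempty (shrink G)
    shrink-nonempty {G} ne with G ≟ˢ F₀
    ... | yes _ = x , x∈⁅x⁆ x
    ... | no _  = ne

    shrink-injective : ∀ {G H} → G ∈ˡ L → H ∈ˡ L → shrink G ≡ shrink H → G ≡ H
    shrink-injective {G} {H} G∈ H∈ eq with G ≟ˢ F₀ | H ≟ˢ F₀
    ... | yes G≡F₀ | yes H≡F₀ = trans G≡F₀ (sym H≡F₀)
    ... | yes _    | no _     = contradiction (subst (_∈ˡ L) (sym eq) H∈) ⁅x⁆∉L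
    ... | no _     | yes _    = contradiction (subst (_∈ˡ L) eq G∈) ⁅x⁆∉L
    ... | no _     | no _     = eq

    L′ : List (Subset n)
    L′ = map shrink L

    sparse′ : Sparse k L′
    sparse′ .unique = map-unique shrink-injective (unique sparse)
    sparse′ .nonempty G∈ with ∈-map⁻ shrink G∈
    ... | H , H∈ , refl = shrink-nonempty (nonempty sparse H∈)
    sparse′ .few G∈ with ∈-map⁻ shrink G∈
    ... | H , H∈ , refl = begin
      ∑[ G ← L′ ] 𝟙 (meets? (shrink H) G)          ≡⟨ ∑-map L shrink ⟩
      ∑[ G ← L ] 𝟙 (meets? (shrink H) (shrink G))  ≤⟨ ∑-mono L (λ {G} _ →
        𝟙-mono (meets? (shrink H) (shrink G)) (meets? H G)
          (meets-mono (shrink-⊆ H) (shrink-⊆ G))) ⟩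
      ∑[ G ← L ] 𝟙 (meets? H G)                    ≤⟨ few sparse H∈ ⟩
      suc k                                        ∎
      where open ≤-Reasoning

    closed-x : Closed L′ x
    closed-x _ _ = subst (_∈ˡ L′) shrink-F₀ (∈-map⁺ shrink F₀∈L)

    closed-y : ∀ {y} → Closed L y → Closed L′ y
    closed-y {y} closed G∈ y∈G with ∈-map⁻ shrink G∈
    ... | H , H∈ , refl = subst (_∈ˡ L′) (shrink-other ⁅y⁆≢F₀) (∈-map⁺ shrink ⁅y⁆∈L)
      where
      ⁅y⁆∈L : ⁅ y ⁆ ∈ˡ L
      ⁅y⁆∈L = closed H∈ (shrink-⊆ H y∈G)

      ⁅y⁆≢F₀ : ⁅ y ⁆ ≢ F₀
      ⁅y⁆≢F₀ refl with x∈⁅y⁆⇒x≡y y x∈F₀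
      ... | refl = ⁅x⁆∉L F₀∈L

  close-one : ∀ {n k} {L : List (Subset n)} → Sparse k L → ∀ x →
    ∃ λ L′ → Sparse k L′ × length L′ ≡ length L × Closed L′ x ×
             (∀ {y} → Closed L y → Closed L′ y)
  close-one {L = L} sparse x with any? (⁅ x ⁆ ≟ˢ_) L | any? (x ∈?_) L
  ... | yes ⁅x⁆∈L | _     = L , sparse , refl , (λ _ _ → ⁅x⁆∈L) , λ {_} c → c
  ... | no ⁅x⁆∉L | no ¬any = L , sparse , refl ,
    (λ F∈ x∈F → ⊥-elim (¬any (Any.map (λ { refl → x∈F }) F∈))) , λ {_} c → c
  ... | no ⁅x⁆∉L | yes any with find any
  ...   | F₀ , F₀∈L , x∈F₀ =
    L′ , sparse′ , length-map shrink L , (λ {_} → closed-x) , λ {_} → closed-y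
    where open Shrink sparse F₀∈L x∈F₀ ⁅x⁆∉L

  close-all : ∀ {n k} {L : List (Subset n)} → Sparse k L → (xs : List (Fin n)) →
    ∃ λ L′ → Sparse k L′ × length L′ ≡ length L ×
             (∀ {x} → x ∈ˡ xs → Closed L′ x)
  close-all {L = L} sparse []       = L , sparse , refl , λ ()
  close-all         sparse (x ∷ xs) with close-all sparse xs
  ... | L₁ , sparse₁ , len₁ , closed₁ with close-one sparse₁ x
  ...   | L₂ , sparse₂ , len₂ , closed-x , keep =
    L₂ , sparse₂ , trans len₂ len₁ ,
    λ { (here refl) {F} → closed-x {F} ; (there y∈) {F} → keep (closed₁ y∈) {F} }

  module _ {n k : ℕ} {L : List (Subset n)} (sparse : Sparse k L)
           (closed : ∀ x → Closed L x) where

    -- The members with at least two elements are B, the singletons S.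
    large? : (F : Subset n) → Dec (1 < ∣ F ∣)
    large? F = 1 <? ∣ F ∣

    B S : List (Subset n)
    B = filter large? L
    S = filter (¬? ∘ large?) L

    length-singletons : length S ≤ n
    length-singletons = begin
      length S                      ≤⟨ unique⇒length≤
        (Unique.filter⁺ (¬? ∘ large?) (unique sparse)) singleton ⟩
      length (map ⁅_⁆ (allFin n))   ≡⟨ length-map ⁅_⁆ (allFin n) ⟩
      length (allFin n)             ≡⟨ length-tabulate {n = n} id ⟩
      n                             ∎
      where
      open ≤-Reasoning
      singleton : ∀ {F} → F ∈ˡ S → F ∈ˡ map ⁅_⁆ (allFin n)
      singleton F∈S with ∈-filter⁻ (¬? ∘ large?) {xs = L} F∈S
      ... | F∈L , ¬large with ∣∣≡1⇒⁅⁆ (nonempty sparse F∈L) (≮⇒≥ ¬large)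
      ...   | x , refl = ∈-map⁺ ⁅_⁆ (∈-allFin x)

    -- The singletons of the elements of F are listed, and F meets them.
    singletons-met : ∀ {F} → F ∈ˡ L → ∣ F ∣ ≤ ∑[ G ← S ] 𝟙 (meets? F G)
    singletons-met {F} F∈L = begin
      ∣ F ∣                            ≡⟨ sym (length-elements F) ⟩
      length (elements F)              ≡⟨ sym (length-map ⁅_⁆ (elements F)) ⟩
      length (map ⁅_⁆ (elements F))    ≤⟨ unique⇒length≤
        (Unique.map⁺ ⁅⁆-injective (Unique.filter⁺ (_∈? F) (Unique.allFin⁺ n))) met ⟩
      length (filter (meets? F) S)     ≡⟨ length-filter-∑ (meets? F) S ⟩
      ∑[ G ← S ] 𝟙 (meets? F G)        ∎
      where
      open ≤-Reasoning
      met : ∀ {G} → G ∈ˡ map ⁅_⁆ (elements F) → G ∈ˡ filter (meets? F) S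
      met G∈ with ∈-map⁻ ⁅_⁆ G∈
      ... | x , x∈ , refl = ∈-filter⁺ (meets? F)
        (∈-filter⁺ (¬? ∘ large?) (closed x F∈L x∈F)
          (λ large → <-irrefl (sym (∣⁅x⁆∣≡1 x)) large))
        (common⇒meets x∈F (x∈⁅x⁆ x))
        where
        x∈F : x ∈ F
        x∈F = elements-∈ x∈

    closed-bound : k * length L ≤ n * (k ^ 2 / 4) + k * n
    closed-bound = begin
      k * length L                   ≡⟨ cong (k *_) length-split ⟩
      k * (length S + length B)      ≡⟨ *-distribˡ-+ k (length S) (length B) ⟩
      k * length S + k * length B    ≤⟨ +-mono-≤ (*-monoʳ-≤ k length-singletons)
                                          (large-members k B! large few-large) ⟩
      k * n + n * (k ^ 2 / 4)        ≡⟨ +-comm (k * n) _ ⟩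
      n * (k ^ 2 / 4) + k * n        ∎
      where
      open ≤-Reasoning
      length-split : length L ≡ length S + length B
      length-split = trans (length-∑ L) (trans (∑-partition large? L)
        (sym (cong₂ _+_ (length-∑ S) (length-∑ B))))

      B! : Unique B
      B! = Unique.filter⁺ large? (unique sparse)

      large : ∀ {F} → F ∈ˡ B → 1 < ∣ F ∣
      large F∈B = proj₂ (∈-filter⁻ large? {xs = L} F∈B)

      few-large : ∀ {F} → F ∈ˡ B → ∑[ G ← B ] 𝟙 (meets? F G) + ∣ F ∣ ≤ suc k
      few-large {F} F∈B = begin
        ∑[ G ← B ] 𝟙 (meets? F G) + ∣ F ∣
          ≡⟨ +-comm _ ∣ F ∣ ⟩
        ∣ F ∣ + ∑[ G ← B ] 𝟙 (meets? F G)
          ≤⟨ +-monoˡ-≤ _ (singletons-met F∈L) ⟩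
        ∑[ G ← S ] 𝟙 (meets? F G) + ∑[ G ← B ] 𝟙 (meets? F G)
          ≡⟨ sym (∑-partition large? L) ⟩
        ∑[ G ← L ] 𝟙 (meets? F G)
          ≤⟨ few sparse F∈L ⟩
        suc k ∎
        where
        F∈L = proj₁ (∈-filter⁻ large? {xs = L} F∈B)

  sparse-bound : ∀ {n k} {L : List (Subset n)} → Sparse k L →
                 k * length L ≤ n * (k ^ 2 / 4) + k * n
  sparse-bound {n} {k} sparse with close-all sparse (allFin n)
  ... | L′ , sparse′ , len , closed = subst (λ l → k * l ≤ _) len
    (closed-bound sparse′ λ x → closed (∈-allFin x))

  module _ {n : ℕ} (k : ℕ) (𝓕 : Family n) (almost : AlmostFisher k 0 𝓕) where

    nonzero? : (F : Subset n) → Dec (∣ F ∣ ≢ 0)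
    nonzero? F = ¬? (∣ F ∣ ≟ 0)

    -- The nonempty members.
    L : List (Subset n)
    L = filter nonzero? (members 𝓕)

    empties-≤1 : length (filter (¬? ∘ nonzero?) (members 𝓕)) ≤ 1
    empties-≤1 = unique⇒length≤ {ys = ⊥ ∷ []}
      (Unique.filter⁺ (¬? ∘ nonzero?) (distinct 𝓕)) λ F∈ → here (empty (proj₂
        (∈-filter⁻ (¬? ∘ nonzero?) {xs = members 𝓕} F∈)))
      where
      empty : ∀ {F : Subset n} → ¬ (∣ F ∣ ≢ 0) → F ≡ ⊥
      empty ¬≢0 = Empty-unique λ ne → ¬≢0 (>⇒≢ (nonempty⇒∣∣>0 ne))

    members-sparse : Sparse k L
    members-sparse .unique = Unique.filter⁺ nonzero? (distinct 𝓕)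
    members-sparse .nonempty F∈ =
      ∣∣>0⇒nonempty (n≢0⇒n>0 (proj₂ (∈-filter⁻ nonzero? {xs = members 𝓕} F∈)))
    members-sparse .few {F} F∈L = begin
      ∑[ G ← L ] 𝟙 (meets? F G)
        ≡⟨ ∑-filter nonzero? M ⟩
      ∑[ G ← M ] (𝟙 (nonzero? G) * 𝟙 (meets? F G))
        ≤⟨ ∑-mono M (λ {G} _ → split G) ⟩
      ∑[ G ← M ] (𝟙 (G ≟ˢ F) + 𝟙 (exception? G))
        ≡⟨ ∑-+ M ⟩
      ∑[ G ← M ] 𝟙 (G ≟ˢ F) + ∑[ G ← M ] 𝟙 (exception? G)
        ≡⟨ cong₂ _+_ (∑-point-1 (_≟ˢ F) (distinct 𝓕) F∈M)
             (sym (length-filter-∑ exception? M)) ⟩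
      suc (length (exceptions 0 M F))
        ≤⟨ s≤s (All.lookup almost F∈M) ⟩
      suc k ∎
      where
      open ≤-Reasoning
      M = members 𝓕

      F∈M : F ∈ˡ M
      F∈M = proj₁ (∈-filter⁻ nonzero? F∈L)

      exception? : (G : Subset n) → Dec (G ≢ F × ∣ F ∩ G ∣ ≢ 0)
      exception? G = ¬? (G ≟ˢ F) ×-dec ¬? (∣ F ∩ G ∣ ≟ 0)

      split : ∀ G → 𝟙 (nonzero? G) * 𝟙 (meets? F G) ≤ 𝟙 (G ≟ˢ F) + 𝟙 (exception? G)
      split G = begin
        𝟙 (nonzero? G) * 𝟙 (meets? F G)      ≤⟨ *-monoˡ-≤ (𝟙 (meets? F G)) (𝟙≤1 (nonzero? G)) ⟩
        1 * 𝟙 (meets? F G)                   ≡⟨ *-identityˡ (𝟙 (meets? F G)) ⟩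
        𝟙 (meets? F G)                       ≤⟨ 𝟙-⊎ (meets? F G) (G ≟ˢ F) (exception? G)
                                                  (cases (G ≟ˢ F)) ⟩
        𝟙 (G ≟ˢ F) + 𝟙 (exception? G)        ∎
        where
        cases : Dec (G ≡ F) → ∣ F ∩ G ∣ ≢ 0 → G ≡ F ⊎ (G ≢ F × ∣ F ∩ G ∣ ≢ 0)
        cases (yes G≡F) _    = inj₁ G≡F
        cases (no G≢F)  meet = inj₂ (G≢F , meet)

    size-bound : k * size 𝓕 ≤ n * (k ^ 2 / 4) + k * n + k
    size-bound = begin
      k * size 𝓕              ≤⟨ *-monoʳ-≤ k size≤ ⟩
      k * (length L + 1)      ≡⟨ *-distribˡ-+ k (length L) 1 ⟩
      k * length L + k * 1    ≤⟨ +-mono-≤ (sparse-bound members-sparse)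
                                   (≤-reflexive (*-identityʳ k)) ⟩
      n * (k ^ 2 / 4) + k * n + k ∎
      where
      open ≤-Reasoning
      size≤ : size 𝓕 ≤ length L + 1
      size≤ = begin
        size 𝓕                                     ≡⟨ length-∑ (members 𝓕) ⟩
        ∑[ _ ← members 𝓕 ] 1                       ≡⟨ ∑-partition nonzero? (members 𝓕) ⟩
        ∑[ _ ← E ] 1 + ∑[ _ ← L ] 1                ≡⟨ sym (cong₂ _+_ (length-∑ E) (length-∑ L)) ⟩
        length E + length L                        ≤⟨ +-monoˡ-≤ (length L) empties-≤1 ⟩
        1 + length L                               ≡⟨ +-comm 1 (length L) ⟩
        length L + 1                               ∎
        where E = filter (¬? ∘ nonzero?) (members 𝓕)

-- The family of a graph

module Graphs where

  open Sums
  open Subsets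
  open import Defs
  open import Data.Fin using (Fin; _<?_) renaming (_<_ to _<ᶠ_)
  import Data.Fin.Properties as Finₚ
  open import Data.Fin.Subset
  open import Data.Fin.Subset.Properties
  open import Data.List
    using (List; _∷_; _++_; map; length; filter; allFin; cartesianProduct)
  open import Data.List.Membership.Propositional using () renaming (_∈_ to _∈ˡ_)
  open import Data.List.Membership.Propositional.Properties
    using (∈-filter⁻; ∈-map⁻; ∈-++⁻; ∈-allFin)
  open import Data.List.Properties using (length-map; length-tabulate; length-++)
  open import Data.List.Relation.Binary.Disjoint.Propositional using (Disjoint)
  import Data.List.Relation.Unary.All as All
  open import Data.List.Relation.Unary.AllPairs using (_∷_)
  open import Data.List.Relation.Unary.Any using (here; there)
  open import Data.List.Relation.Unary.Unique.Propositional using (Unique)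
  import Data.List.Relation.Unary.Unique.Propositional.Properties as Unique
  open import Data.Nat using (ℕ; suc; _+_; _*_; _≤_; z≤n)
  open import Data.Nat.Properties hiding (_<?_)
  open import Data.Nat.Tactic.RingSolver using (solve-∀)
  open import Data.Product using (_×_; _,_; proj₁; proj₂)
  open import Data.Product.Properties using (≡-dec)
  open import Data.Sum using (_⊎_; inj₁; inj₂; [_,_]′)
  open import Function using (_∘_; id)
  open import Relation.Binary.Definitions using (tri<; tri≈; tri>)
  open import Relation.Binary.PropositionalEquality
  open import Relation.Nullary using (Dec; yes; no; ¬_; contradiction)
  open import Relation.Nullary.Decidable using (¬?; _×-dec_)

  -- A finite simple graph with decidable adjacency.
  record Graph (n : ℕ) : Set₁ where
    infix 4 _~_ _~?_
    field
      _~_      : Fin n → Fin n → Set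
      _~?_     : ∀ x y → Dec (x ~ y)
      ~-sym    : ∀ {x y} → x ~ y → y ~ x
      ~-irrefl : ∀ {x} → ¬ (x ~ x)

    -- The number of neighbours.
    deg : Fin n → ℕ
    deg x = ∑[ y ← allFin n ] 𝟙 (x ~? y)

  module GraphFamily {n : ℕ} (G : Graph n) where

    open Graph G

    V : List (Fin n)
    V = allFin n

    ordered-edge? : (e : Fin n × Fin n) → Dec (proj₁ e <ᶠ proj₂ e × proj₁ e ~ proj₂ e)
    ordered-edge? (u , v) = (u <? v) ×-dec (u ~? v)

    -- Every edge once, with its ends in increasing order.
    E : List (Fin n × Fin n)
    E = filter ordered-edge? (cartesianProduct V V)

    E! : Unique E
    E! = Unique.filter⁺ ordered-edge?
      (Unique.cartesianProduct⁺ (Unique.allFin⁺ n) (Unique.allFin⁺ n))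

    ∈E⇒ordered : ∀ {u v} → (u , v) ∈ˡ E → u <ᶠ v × u ~ v
    ∈E⇒ordered e∈ = proj₂ (∈-filter⁻ ordered-edge? {xs = cartesianProduct V V} e∈)

    -- The indicator of E.
    w : Fin n → Fin n → ℕ
    w u v = 𝟙 (ordered-edge? (u , v))

    ∑-E : ∀ {f} → ∑ E f ≡ ∑[ u ← V ] ∑[ v ← V ] (w u v * f (u , v))
    ∑-E = trans (∑-filter ordered-edge? (cartesianProduct V V)) (∑-cartesianProduct V V)

    ~-split : ∀ u v → 𝟙 (u ~? v) ≡ w u v + w v u
    ~-split u v with Finₚ.<-cmp u v
    ... | tri< u<v _ v≮u = begin
      𝟙 (u ~? v)     ≡⟨ 𝟙-cong (u ~? v) (ordered-edge? (u , v)) (u<v ,_) proj₂ ⟩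
      w u v          ≡⟨ sym (+-identityʳ (w u v)) ⟩
      w u v + 0      ≡⟨ cong (w u v +_) (sym (𝟙-no (ordered-edge? (v , u)) (v≮u ∘ proj₁))) ⟩
      w u v + w v u  ∎
      where open ≡-Reasoning
    ... | tri> u≮v _ v<u = begin
      𝟙 (u ~? v)     ≡⟨ 𝟙-cong (u ~? v) (ordered-edge? (v , u))
                          (λ u~v → v<u , ~-sym u~v) (~-sym ∘ proj₂) ⟩
      w v u          ≡⟨ cong (_+ w v u) (sym (𝟙-no (ordered-edge? (u , v)) (u≮v ∘ proj₁))) ⟩
      w u v + w v u  ∎
      where open ≡-Reasoning
    ... | tri≈ _ refl _ = trans (𝟙-no (u ~? u) ~-irrefl)
      (sym (cong₂ _+_ w≡0 w≡0))
      where
      w≡0 : w u u ≡ 0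
      w≡0 = 𝟙-no (ordered-edge? (u , u)) (~-irrefl ∘ proj₂)

    handshake : ∑ V deg ≡ 2 * length E
    handshake = begin
      ∑[ u ← V ] ∑[ v ← V ] 𝟙 (u ~? v)
        ≡⟨ ∑-cong V (λ {u} _ → trans (∑-cong V λ {v} _ → ~-split u v) (∑-+ V)) ⟩
      ∑[ u ← V ] (∑[ v ← V ] w u v + ∑[ v ← V ] w v u)
        ≡⟨ ∑-+ V ⟩
      W + ∑[ u ← V ] ∑[ v ← V ] w v u
        ≡⟨ cong (W +_) (∑-swap V V) ⟩
      W + W
        ≡⟨ sym (cong₂ _+_ length-E (trans (+-identityʳ (length E)) length-E)) ⟩
      2 * length E ∎
      where
      open ≡-Reasoning
      W = ∑[ u ← V ] ∑[ v ← V ] w u v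

      length-E : length E ≡ W
      length-E = trans (length-∑ E) (trans ∑-E
        (∑-cong V λ {u} _ → ∑-cong V λ {v} _ → *-identityʳ (w u v)))

    -- The set of the two ends.
    edge : Fin n × Fin n → Subset n
    edge (u , v) = ⁅ u ⁆ ∪ ⁅ v ⁆

    ∈edge⁻ : ∀ {x u v} → x ∈ edge (u , v) → u ≡ x ⊎ v ≡ x
    ∈edge⁻ {x} {u} {v} x∈ with x∈p∪q⁻ ⁅ u ⁆ ⁅ v ⁆ x∈
    ... | inj₁ x∈u = inj₁ (sym (x∈⁅y⁆⇒x≡y u x∈u))
    ... | inj₂ x∈v = inj₂ (sym (x∈⁅y⁆⇒x≡y v x∈v))

    left∈ : ∀ u v → u ∈ edge (u , v)
    left∈ u v = x∈p∪q⁺ (inj₁ (x∈⁅x⁆ u))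

    right∈ : ∀ u v → v ∈ edge (u , v)
    right∈ u v = x∈p∪q⁺ (inj₂ (x∈⁅x⁆ v))

    edge-injective : ∀ {e e′} → e ∈ˡ E → e′ ∈ˡ E → edge e ≡ edge e′ → e ≡ e′
    edge-injective {u , v} {u′ , v′} e∈ e′∈ eq
      with ∈edge⁻ {u = u′} {v′} (subst (u ∈_) eq (left∈ u v))
         | ∈edge⁻ {u = u′} {v′} (subst (v ∈_) eq (right∈ u v))
    ... | inj₁ refl | inj₁ refl = contradiction (proj₁ (∈E⇒ordered e∈)) (Finₚ.<-irrefl refl)
    ... | inj₁ refl | inj₂ refl = refl
    ... | inj₂ refl | inj₁ refl = contradiction
      (proj₁ (∈E⇒ordered e∈)) (Finₚ.<-asym (proj₁ (∈E⇒ordered e′∈)))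
    ... | inj₂ refl | inj₂ refl = contradiction (proj₁ (∈E⇒ordered e∈)) (Finₚ.<-irrefl refl)

    edges-at : ∀ x → ∑[ e ← E ] 𝟙 (x ∈? edge e) ≤ deg x
    edges-at x = begin
      ∑[ e ← E ] 𝟙 (x ∈? edge e)
        ≤⟨ ∑-mono E (λ {e} _ → end e) ⟩
      ∑[ e ← E ] (𝟙 (proj₁ e Finₚ.≟ x) + 𝟙 (proj₂ e Finₚ.≟ x))
        ≡⟨ ∑-E ⟩
      ∑[ u ← V ] ∑[ v ← V ] (w u v * (𝟙 (u Finₚ.≟ x) + 𝟙 (v Finₚ.≟ x)))
        ≡⟨ ∑-cong V (λ {u} _ → trans
             (∑-cong V λ {v} _ → distribute (w u v) (𝟙 (u Finₚ.≟ x)) (𝟙 (v Finₚ.≟ x)))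
             (trans (∑-+ V) (cong₂ _+_ (∑-*ˡ V (𝟙 (u Finₚ.≟ x))) (∑-allFin-point x)))) ⟩
      ∑[ u ← V ] (𝟙 (u Finₚ.≟ x) * ∑[ v ← V ] w u v + w u x)
        ≡⟨ trans (∑-+ V) (cong (_+ ∑[ u ← V ] w u x) (∑-allFin-point x)) ⟩
      ∑[ v ← V ] w x v + ∑[ v ← V ] w v x
        ≡⟨ sym (∑-+ V) ⟩
      ∑[ v ← V ] (w x v + w v x)
        ≡⟨ ∑-cong V (λ {v} _ → sym (~-split x v)) ⟩
      deg x ∎
      where
      open ≤-Reasoning
      distribute : ∀ a b c → a * (b + c) ≡ b * a + c * a
      distribute = solve-∀

      end : ∀ e → 𝟙 (x ∈? edge e) ≤ 𝟙 (proj₁ e Finₚ.≟ x) + 𝟙 (proj₂ e Finₚ.≟ x)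
      end (u , v) =
        𝟙-⊎ (x ∈? edge (u , v)) (u Finₚ.≟ x) (v Finₚ.≟ x) (∈edge⁻ {u = u} {v})

    -- The family consists of the empty set, the singletons and the edges.
    singletons pairs sets : List (Subset n)
    singletons = map ⁅_⁆ V
    pairs      = map edge E
    sets       = ⊥ ∷ singletons ++ pairs

    sets! : Unique sets
    sets! = All.tabulate ∅≢ ∷ Unique.++⁺
      (Unique.map⁺ ⁅⁆-injective (Unique.allFin⁺ n)) (map-unique edge-injective E!) disjoint
      where
      ∅≢ : ∀ {F} → F ∈ˡ singletons ++ pairs → ⊥ ≢ F
      ∅≢ F∈ refl with ∈-++⁻ singletons F∈
      ... | inj₁ ∅∈ with ∈-map⁻ ⁅_⁆ ∅∈
      ...   | x , _ , eq = ∉⊥ (subst (x ∈_) (sym eq) (x∈⁅x⁆ x))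
      ∅≢ F∈ refl | inj₂ ∅∈ with ∈-map⁻ edge ∅∈
      ...   | (u , v) , _ , eq = ∉⊥ (subst (u ∈_) (sym eq) (left∈ u v))

      disjoint : Disjoint singletons pairs
      disjoint (F∈S , F∈P) with ∈-map⁻ ⁅_⁆ F∈S | ∈-map⁻ edge F∈P
      ... | x , _ , refl | (u , v) , e∈ , eq
        with x∈⁅y⁆⇒x≡y x (subst (u ∈_) (sym eq) (left∈ u v))
           | x∈⁅y⁆⇒x≡y x (subst (v ∈_) (sym eq) (right∈ u v))
      ...   | refl | refl = Finₚ.<-irrefl refl (proj₁ (∈E⇒ordered e∈))

    graphFamily : Family n
    graphFamily = family sets sets!

    size-graphFamily : size graphFamily ≡ suc (n + length E)
    size-graphFamily = cong suc (trans (length-++ singletons) (cong₂ _+_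
      (trans (length-map ⁅_⁆ V) (length-tabulate {n = n} id)) (length-map edge E)))

    -- An edge meets the singletons of its two ends, and at most deg x + deg y - 2
    -- other edges.
    graphFamily-almostFisher : ∀ {k} → (∀ x → deg x ≤ k) →
      (∀ {x y} → x ~ y → deg x + deg y ≤ k) → AlmostFisher k 0 graphFamily
    graphFamily-almostFisher {k} deg≤ deg+deg≤ = All.tabulate few
      where
      open ≤-Reasoning

      exception? : (F G : Subset n) → Dec (G ≢ F × ∣ F ∩ G ∣ ≢ 0)
      exception? F G = ¬? (G ≟ˢ F) ×-dec ¬? (∣ F ∩ G ∣ ≟ 0)

      -- The empty set is disjoint from every set, so it is never an exception.
      count : ∀ F → length (exceptions 0 sets F) ≡
        ∑[ x ← V ] 𝟙 (exception? F ⁅ x ⁆) + ∑[ e ← E ] 𝟙 (exception? F (edge e))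
      count F = trans (length-filter-∑ (exception? F) sets) (cong₂ _+_
        (𝟙-no (exception? F ⊥) λ (_ , meet) → ∉⊥ (proj₂ (proj₂ (meets⇒common F ⊥ meet))))
        (trans (∑-++ singletons pairs) (cong₂ _+_ (∑-map V ⁅_⁆) (∑-map E edge))))

      none-meet-∅ : ∀ {G : Subset n} → ¬ (G ≢ ⊥ × ∣ ⊥ ∩ G ∣ ≢ 0)
      none-meet-∅ {G} (_ , meet) = ∉⊥ (proj₁ (proj₂ (meets⇒common ⊥ G meet)))

      few-∅ : length (exceptions 0 sets ⊥) ≡ 0
      few-∅ = trans (count ⊥) (cong₂ _+_
        (∑-zero V λ {x} _ → 𝟙-no (exception? ⊥ ⁅ x ⁆) none-meet-∅)
        (∑-zero E λ {e} _ → 𝟙-no (exception? ⊥ (edge e)) none-meet-∅))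

      few-singleton : ∀ x → length (exceptions 0 sets ⁅ x ⁆) ≤ deg x
      few-singleton x = begin
        length (exceptions 0 sets ⁅ x ⁆)
          ≡⟨ count ⁅ x ⁆ ⟩
        ∑[ z ← V ] 𝟙 (exception? ⁅ x ⁆ ⁅ z ⁆) + ∑[ e ← E ] 𝟙 (exception? ⁅ x ⁆ (edge e))
          ≡⟨ cong (_+ ∑[ e ← E ] 𝟙 (exception? ⁅ x ⁆ (edge e)))
               (∑-zero V λ {z} _ → 𝟙-no (exception? ⁅ x ⁆ ⁅ z ⁆) apart) ⟩
        ∑[ e ← E ] 𝟙 (exception? ⁅ x ⁆ (edge e))
          ≤⟨ ∑-mono E (λ {e} _ → 𝟙-mono (exception? ⁅ x ⁆ (edge e)) (x ∈? edge e)
               λ (_ , meet) → x∈ meet) ⟩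
        ∑[ e ← E ] 𝟙 (x ∈? edge e)
          ≤⟨ edges-at x ⟩
        deg x ∎
        where
        x∈ : ∀ {F} → ∣ ⁅ x ⁆ ∩ F ∣ ≢ 0 → x ∈ F
        x∈ {F} meet with meets⇒common ⁅ x ⁆ F meet
        ... | y , y∈⁅x⁆ , y∈F = subst (_∈ F) (x∈⁅y⁆⇒x≡y x y∈⁅x⁆) y∈F

        apart : ∀ {z} → ¬ (⁅ z ⁆ ≢ ⁅ x ⁆ × ∣ ⁅ x ⁆ ∩ ⁅ z ⁆ ∣ ≢ 0)
        apart {z} (z≢x , meet) = z≢x (cong ⁅_⁆ (sym (x∈⁅y⁆⇒x≡y z (x∈ meet))))

      -- The edge itself is counted at both of its ends, but is no exception; this
      -- makes up for the two singletons.
      few-pair : ∀ {x y} → (x , y) ∈ˡ E →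
                 length (exceptions 0 sets (edge (x , y))) ≤ deg x + deg y
      few-pair {x} {y} e∈ = begin
        length (exceptions 0 sets F)
          ≡⟨ count F ⟩
        ∑[ z ← V ] 𝟙 (exception? F ⁅ z ⁆) + ∑[ e ← E ] 𝟙 (exception? F (edge e))
          ≤⟨ +-monoˡ-≤ _ ends ⟩
        2 + ∑[ e ← E ] 𝟙 (exception? F (edge e))
          ≡⟨ cong (_+ ∑[ e ← E ] 𝟙 (exception? F (edge e))) (sym (trans (∑-*ˡ E 2)
               (cong (2 *_) (∑-point-1 (_≟ᵉ (x , y)) E! e∈)))) ⟩
        ∑[ e ← E ] (2 * 𝟙 (e ≟ᵉ (x , y))) + ∑[ e ← E ] 𝟙 (exception? F (edge e))
          ≡⟨ sym (∑-+ E) ⟩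
        ∑[ e ← E ] (2 * 𝟙 (e ≟ᵉ (x , y)) + 𝟙 (exception? F (edge e)))
          ≤⟨ ∑-mono E (λ {e} _ → pointwise e (e ≟ᵉ (x , y))) ⟩
        ∑[ e ← E ] (𝟙 (x ∈? edge e) + 𝟙 (y ∈? edge e))
          ≡⟨ ∑-+ E ⟩
        ∑[ e ← E ] 𝟙 (x ∈? edge e) + ∑[ e ← E ] 𝟙 (y ∈? edge e)
          ≤⟨ +-mono-≤ (edges-at x) (edges-at y) ⟩
        deg x + deg y ∎
        where
        F = edge (x , y)

        _≟ᵉ_ : (e e′ : Fin n × Fin n) → Dec (e ≡ e′)
        _≟ᵉ_ = ≡-dec Finₚ._≟_ Finₚ._≟_

        either : ∀ {z} → z ∈ F → x ≡ z ⊎ y ≡ z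
        either = ∈edge⁻ {u = x} {y}

        ends : ∑[ z ← V ] 𝟙 (exception? F ⁅ z ⁆) ≤ 2
        ends = begin
          ∑[ z ← V ] 𝟙 (exception? F ⁅ z ⁆)
            ≤⟨ ∑-mono V (λ {z} _ → 𝟙-⊎ (exception? F ⁅ z ⁆) (z Finₚ.≟ x) (z Finₚ.≟ y)
                 λ (_ , meet) → which meet) ⟩
          ∑[ z ← V ] (𝟙 (z Finₚ.≟ x) + 𝟙 (z Finₚ.≟ y))
            ≡⟨ ∑-+ V ⟩
          ∑[ z ← V ] 𝟙 (z Finₚ.≟ x) + ∑[ z ← V ] 𝟙 (z Finₚ.≟ y)
            ≡⟨ cong₂ _+_ (one x) (one y) ⟩
          2 ∎
          where
          one : ∀ a → ∑[ z ← V ] 𝟙 (z Finₚ.≟ a) ≡ 1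
          one a = ∑-point-1 (Finₚ._≟ a) (Unique.allFin⁺ n) (∈-allFin a)

          which : ∀ {z} → ∣ F ∩ ⁅ z ⁆ ∣ ≢ 0 → z ≡ x ⊎ z ≡ y
          which {z} meet with meets⇒common F ⁅ z ⁆ meet
          ... | t , t∈F , t∈⁅z⁆ with x∈⁅y⁆⇒x≡y z t∈⁅z⁆
          ...   | refl = [ inj₁ ∘ sym , inj₂ ∘ sym ]′ (either t∈F)

        pointwise : ∀ e → Dec (e ≡ (x , y)) →
          2 * 𝟙 (e ≟ᵉ (x , y)) + 𝟙 (exception? F (edge e)) ≤
          𝟙 (x ∈? edge e) + 𝟙 (y ∈? edge e)
        pointwise e (yes refl) = ≤-reflexive (trans
          (cong₂ (λ a b → 2 * a + b) (𝟙-yes (e ≟ᵉ e) refl)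
            (𝟙-no (exception? F F) λ (F≢F , _) → F≢F refl))
          (sym (cong₂ _+_ (𝟙-yes (x ∈? F) (left∈ x y)) (𝟙-yes (y ∈? F) (right∈ x y)))))
        pointwise e (no e≢) = begin
          2 * 𝟙 (e ≟ᵉ (x , y)) + 𝟙 (exception? F (edge e))
            ≡⟨ cong (λ a → 2 * a + 𝟙 (exception? F (edge e))) (𝟙-no (e ≟ᵉ (x , y)) e≢) ⟩
          𝟙 (exception? F (edge e))
            ≤⟨ 𝟙-⊎ (exception? F (edge e)) (x ∈? edge e) (y ∈? edge e)
                 (λ (_ , meet) → shared meet) ⟩
          𝟙 (x ∈? edge e) + 𝟙 (y ∈? edge e) ∎
          where
          shared : ∣ F ∩ edge e ∣ ≢ 0 → x ∈ edge e ⊎ y ∈ edge e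
          shared meet with meets⇒common F (edge e) meet
          ... | t , t∈F , t∈e with either t∈F
          ...   | inj₁ refl = inj₁ t∈e
          ...   | inj₂ refl = inj₂ t∈e

      few : ∀ {F} → F ∈ˡ sets → length (exceptions 0 sets F) ≤ k
      few (here refl) = ≤-trans (≤-reflexive few-∅) z≤n
      few (there F∈) with ∈-++⁻ singletons F∈
      ... | inj₁ F∈S with ∈-map⁻ ⁅_⁆ F∈S
      ...   | x , _ , refl = ≤-trans (few-singleton x) (deg≤ x)
      few (there F∈) | inj₂ F∈P with ∈-map⁻ edge F∈P
      ...   | (x , y) , e∈ , refl = ≤-trans (few-pair e∈) (deg+deg≤ (proj₂ (∈E⇒ordered e∈)))

-- Sums over initial segments of the naturals

module Ranges where

  open Sums
  open import Data.Fin using (Fin; zero; suc; toℕ)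
  open import Data.List using (applyUpTo; upTo; allFin)
  open import Data.List.Membership.Propositional.Properties using (∈-upTo⁻; ∈-upTo⁺)
  open import Data.List.Properties using (length-upTo)
  import Data.List.Relation.Unary.Unique.Propositional.Properties as Unique
  open import Data.Nat using (ℕ; zero; suc; _+_; _*_; _<_)
  open import Data.Nat.Properties
  open import Function using (_∘_)
  open import Relation.Binary.PropositionalEquality

  ∑-applyUpTo : ∀ {A : Set} (h : ℕ → A) n {f : A → ℕ} →
                ∑ (applyUpTo h n) f ≡ ∑ (upTo n) (f ∘ h)
  ∑-applyUpTo h zero        = refl
  ∑-applyUpTo h (suc n) {f} = cong (f (h 0) +_)
    (trans (∑-applyUpTo (h ∘ suc) n) (sym (∑-applyUpTo suc n)))

  range-suc : ∀ n {f : ℕ → ℕ} → ∑ (upTo (suc n)) f ≡ f 0 + ∑ (upTo n) (f ∘ suc)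
  range-suc n {f} = cong (f 0 +_) (∑-applyUpTo suc n)

  range-cong : ∀ n {f g : ℕ → ℕ} → (∀ {i} → i < n → f i ≡ g i) → ∑ (upTo n) f ≡ ∑ (upTo n) g
  range-cong n eq = ∑-cong (upTo n) (eq ∘ ∈-upTo⁻)

  range-const : ∀ n {f : ℕ → ℕ} c → (∀ {i} → i < n → f i ≡ c) → ∑ (upTo n) f ≡ n * c
  range-const n c eq = trans (range-cong n eq)
    (trans (∑-const (upTo n) c) (cong (_* c) (length-upTo n)))

  range-point : ∀ {n a} → a < n → {f : ℕ → ℕ} → ∑[ i ← upTo n ] (𝟙 (i ≟ a) * f i) ≡ f a
  range-point {n} {a} a<n = ∑-point (_≟ a) (Unique.upTo⁺ n) (∈-upTo⁺ a<n)

  range-+ : ∀ m n {f : ℕ → ℕ} →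
            ∑ (upTo (m + n)) f ≡ ∑ (upTo m) f + ∑[ i ← upTo n ] f (m + i)
  range-+ zero    n     = refl
  range-+ (suc m) n {f} = begin
    ∑ (upTo (suc m + n)) f
      ≡⟨ range-suc (m + n) ⟩
    f 0 + ∑ (upTo (m + n)) (f ∘ suc)
      ≡⟨ cong (f 0 +_) (range-+ m n) ⟩
    f 0 + (∑ (upTo m) (f ∘ suc) + rest)
      ≡⟨ sym (+-assoc (f 0) (∑ (upTo m) (f ∘ suc)) rest) ⟩
    f 0 + ∑ (upTo m) (f ∘ suc) + rest
      ≡⟨ cong (_+ rest) (sym (range-suc m)) ⟩
    ∑ (upTo (suc m)) f + rest ∎
    where
    open ≡-Reasoning
    rest = ∑[ i ← upTo n ] f (suc m + i)

  range-last : ∀ n {f : ℕ → ℕ} → ∑ (upTo (suc n)) f ≡ ∑ (upTo n) f + f n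
  range-last n {f} = begin
    ∑ (upTo (suc n)) f              ≡⟨ cong (λ l → ∑ (upTo l) f) (+-comm 1 n) ⟩
    ∑ (upTo (n + 1)) f              ≡⟨ range-+ n 1 ⟩
    ∑ (upTo n) f + (f (n + 0) + 0)  ≡⟨ cong (∑ (upTo n) f +_)
                                         (trans (+-identityʳ _) (cong f (+-identityʳ n))) ⟩
    ∑ (upTo n) f + f n              ∎
    where open ≡-Reasoning

  range-reverse : ∀ n {f g : ℕ → ℕ} → (∀ {i j} → suc (i + j) ≡ n → f i ≡ g j) →
                  ∑ (upTo n) f ≡ ∑ (upTo n) g
  range-reverse zero            eq = refl
  range-reverse (suc n) {f} {g} eq = begin
    ∑ (upTo (suc n)) f          ≡⟨ range-suc n ⟩
    f 0 + ∑ (upTo n) (f ∘ suc)  ≡⟨ cong₂ _+_ (eq refl) (range-reverse n (eq ∘ cong suc)) ⟩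
    g n + ∑ (upTo n) g          ≡⟨ +-comm (g n) _ ⟩
    ∑ (upTo n) g + g n          ≡⟨ sym (range-last n) ⟩
    ∑ (upTo (suc n)) g          ∎
    where open ≡-Reasoning

  range-blocks : ∀ m k {f : ℕ → ℕ} →
    ∑ (upTo (m * k)) f ≡ ∑[ b ← upTo m ] ∑[ r ← upTo k ] f (r + b * k)
  range-blocks zero    k     = refl
  range-blocks (suc m) k {f} = begin
    ∑ (upTo (k + m * k)) f
      ≡⟨ range-+ k (m * k) ⟩
    ∑ (upTo k) f + ∑[ i ← upTo (m * k) ] f (k + i)
      ≡⟨ cong₂ _+_ (∑-cong (upTo k) λ {r} _ → cong f (sym (+-identityʳ r)))
           (trans (range-blocks m k) (∑-cong (upTo m) λ {b} _ → ∑-cong (upTo k) λ {r} _ →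
             cong f (shift k r (b * k)))) ⟩
    ∑[ r ← upTo k ] f (r + 0) + ∑[ b ← upTo m ] ∑[ r ← upTo k ] f (r + suc b * k)
      ≡⟨ sym (range-suc m) ⟩
    ∑[ b ← upTo (suc m) ] ∑[ r ← upTo k ] f (r + b * k) ∎
    where
    open ≡-Reasoning
    shift : ∀ k r c → k + (r + c) ≡ r + (k + c)
    shift k r c = trans (sym (+-assoc k r c)) (trans (cong (_+ c) (+-comm k r)) (+-assoc r k c))

  allFin-range : ∀ n {f : ℕ → ℕ} → ∑[ x ← allFin n ] f (toℕ x) ≡ ∑ (upTo n) f
  allFin-range zero        = refl
  allFin-range (suc n) {f} = trans
    (cong (f 0 +_) (trans (∑-tabulate (Fin.suc {n})) (allFin-range n)))
    (sym (range-suc n))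

-- Regular graphs and unions of bipartite graphs

module Constructions where

  open Sums
  open Ranges
  open Graphs
  open import Data.Empty using (⊥)
  open import Data.Fin using (toℕ)
  open import Data.Fin.Properties using (toℕ<n)
  open import Data.List using (upTo; allFin)
  open import Data.Nat
    using (ℕ; zero; suc; _+_; _*_; _/_; _%_; _≤_; _<_; _<?_; _≤?_; ∣_-_∣; s≤s⁻¹)
  open import Data.Nat.Divisibility using (_∣_; n∣m*n)
  open import Data.Nat.DivMod
    using (m<n⇒m/n≡0; +-distrib-/-∣ʳ; m*n/n≡m; [m+kn]%n≡m%n; m<n⇒m%n≡m; m<n*o⇒m/o<n)
  open import Data.Nat.Properties hiding (_<?_; _≤?_)
  open import Data.Nat.Tactic.RingSolver using (solve-∀)
  open import Data.Product using (∃; Σ; _×_; _,_; proj₁; proj₂)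
  open import Data.Sum using (_⊎_; inj₁; inj₂; [_,_]′; swap)
  open import Function using (_∘_)
  open import Relation.Binary.PropositionalEquality
  open import Relation.Nullary using (Dec; yes; no; ¬_)
  open import Relation.Nullary.Decidable using (¬?; _×-dec_; _⊎-dec_)
  open import Relation.Unary using (Decidable)

  -- The graph on 0, …, N in which x and y are adjacent when their distance is
  -- i + 1 with P i.  If P is a palindrome on 0, …, N - 1, the x vertices below x
  -- and the N - x vertices above x see complementary parts of P, so every
  -- degree is the number of i with P i.
  module Circulant (N : ℕ) {P : ℕ → Set} (P? : Decidable P)
                   (palindrome : ∀ {i j} → suc (i + j) ≡ N → P i → P j) where

    -- The distances that make two vertices adjacent.
    Distance : ℕ → Set
    Distance zero    = ⊥
    Distance (suc i) = P i

    distance? : Decidable Distance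
    distance? zero    = no λ ()
    distance? (suc i) = P? i

    circulant : Graph (suc N)
    circulant = record
      { _~_      = λ x y → Distance ∣ toℕ x - toℕ y ∣
      ; _~?_     = λ x y → distance? ∣ toℕ x - toℕ y ∣
      ; ~-sym    = λ {x} {y} → subst Distance (∣-∣-comm (toℕ x) (toℕ y))
      ; ~-irrefl = λ {x} → subst Distance (∣n-n∣≡0 (toℕ x))
      }

    below : ∀ x → ∑[ y ← upTo x ] 𝟙 (distance? ∣ x - y ∣) ≡ ∑[ i ← upTo x ] 𝟙 (P? i)
    below zero    = refl
    below (suc x) = begin
      ∑[ y ← upTo (suc x) ] 𝟙 (distance? ∣ suc x - y ∣)  ≡⟨ range-suc x ⟩
      𝟙 (P? x) + ∑[ y ← upTo x ] 𝟙 (distance? ∣ x - y ∣) ≡⟨ cong (𝟙 (P? x) +_) (below x) ⟩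
      𝟙 (P? x) + ∑[ i ← upTo x ] 𝟙 (P? i)                ≡⟨ +-comm (𝟙 (P? x)) _ ⟩
      ∑[ i ← upTo x ] 𝟙 (P? i) + 𝟙 (P? x)                ≡⟨ sym (range-last x) ⟩
      ∑[ i ← upTo (suc x) ] 𝟙 (P? i)                     ∎
      where open ≡-Reasoning

    above : ∀ x m → ∑[ i ← upTo (suc m) ] 𝟙 (distance? ∣ x - (x + i) ∣) ≡
                    ∑[ i ← upTo m ] 𝟙 (P? i)
    above x m = trans (∑-cong (upTo (suc m)) λ {i} _ → cong (𝟙 ∘ distance?) (∣m-m+n∣≡n x i))
                      (range-suc m {𝟙 ∘ distance?})

    circulant-deg : ∀ x → Graph.deg circulant x ≡ ∑[ i ← upTo N ] 𝟙 (P? i)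
    circulant-deg x = trans (allFin-range (suc N) {λ y → 𝟙 (distance? ∣ toℕ x - y ∣)})
      (split (m≤n⇒∃[o]m+o≡n (s≤s⁻¹ (toℕ<n x))))
      where
      open ≡-Reasoning
      split : ∀ {a} → ∃ (λ m → a + m ≡ N) →
              ∑[ y ← upTo (suc N) ] 𝟙 (distance? ∣ a - y ∣) ≡ ∑[ i ← upTo N ] 𝟙 (P? i)
      split {a} (m , refl) = begin
        ∑[ y ← upTo (suc (a + m)) ] 𝟙 (distance? ∣ a - y ∣)
          ≡⟨ cong (λ l → ∑[ y ← upTo l ] 𝟙 (distance? ∣ a - y ∣)) (sym (+-suc a m)) ⟩
        ∑[ y ← upTo (a + suc m) ] 𝟙 (distance? ∣ a - y ∣)
          ≡⟨ range-+ a (suc m) ⟩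
        ∑[ y ← upTo a ] 𝟙 (distance? ∣ a - y ∣) +
        ∑[ i ← upTo (suc m) ] 𝟙 (distance? ∣ a - (a + i) ∣)
          ≡⟨ cong₂ _+_ (below a) (above a m) ⟩
        ∑[ i ← upTo a ] 𝟙 (P? i) + ∑[ i ← upTo m ] 𝟙 (P? i)
          ≡⟨ cong (∑[ i ← upTo a ] 𝟙 (P? i) +_) (range-reverse m mirror) ⟩
        ∑[ i ← upTo a ] 𝟙 (P? i) + ∑[ i ← upTo m ] 𝟙 (P? (a + i))
          ≡⟨ sym (range-+ a m) ⟩
        ∑[ i ← upTo (a + m) ] 𝟙 (P? i) ∎
        where
        mirror : ∀ {i j} → suc (i + j) ≡ m → 𝟙 (P? i) ≡ 𝟙 (P? (a + j))
        mirror {i} {j} eq = 𝟙-cong (P? i) (P? (a + j))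
          (palindrome (trans (cong suc (rotate i a j)) total))
          (palindrome (trans (cong suc (rotate′ a j i)) total))
          where
          total : suc (a + (i + j)) ≡ a + m
          total = trans (sym (+-suc a (i + j))) (cong (a +_) eq)
          rotate : ∀ i a j → i + (a + j) ≡ a + (i + j)
          rotate = solve-∀
          rotate′ : ∀ a j i → a + j + i ≡ a + (i + j)
          rotate′ = solve-∀

  -- An h-regular graph on n vertices.
  Regular : ℕ → ℕ → Set₁
  Regular n h = Σ (Graph n) λ G → ∀ x → Graph.deg G x ≡ h

  -- The two palindromes: the a first and the a last positions out of a + z + a,
  -- and the complementary z positions in the middle.
  module _ (a z : ℕ) where

    private N = a + z + a

    Outer : ℕ → Set
    Outer i = i < a ⊎ a + z ≤ i

    outer? : Decidable Outer
    outer? i = (i <? a) ⊎-dec (a + z ≤? i)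

    outer-palindrome : ∀ {i j} → suc (i + j) ≡ N → Outer i → Outer j
    outer-palindrome {i} {j} eq (inj₁ i<a) = inj₂ (+-cancelʳ-≤ a (a + z) j (begin
      a + z + a    ≡⟨ sym eq ⟩
      suc i + j    ≤⟨ +-monoˡ-≤ j i<a ⟩
      a + j        ≡⟨ +-comm a j ⟩
      j + a        ∎))
      where open ≤-Reasoning
    outer-palindrome {i} {j} eq (inj₂ a+z≤i) = inj₁ (+-cancelˡ-≤ (a + z) (suc j) a (begin
      a + z + suc j  ≤⟨ +-monoˡ-≤ (suc j) a+z≤i ⟩
      i + suc j      ≡⟨ +-suc i j ⟩
      suc (i + j)    ≡⟨ eq ⟩
      a + z + a      ∎))
      where open ≤-Reasoning

    inner-palindrome : ∀ {i j} → suc (i + j) ≡ N → ¬ Outer i → ¬ Outer j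
    inner-palindrome {i} {j} eq ¬Oi Oj =
      ¬Oi (outer-palindrome (trans (cong suc (+-comm j i)) eq) Oj)

    outer-first : ∀ {i} → i < a → Outer i
    outer-first = inj₁

    inner-middle : ∀ {i} → i < z → ¬ Outer (a + i)
    inner-middle {i} i<z (inj₁ a+i<a) = m+n≮m a i a+i<a
    inner-middle {i} i<z (inj₂ a+z≤)  = <⇒≱ (+-monoʳ-< a i<z) a+z≤

    outer-last : ∀ i → Outer (a + z + i)
    outer-last i = inj₂ (m≤m+n (a + z) i)

    three-parts : ∀ {P : ℕ → Set} (P? : Decidable P) c d →
      (∀ {i} → i < a → 𝟙 (P? i) ≡ c) → (∀ {i} → i < z → 𝟙 (P? (a + i)) ≡ d) →
      (∀ {i} → i < a → 𝟙 (P? (a + z + i)) ≡ c) →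
      ∑[ i ← upTo N ] 𝟙 (P? i) ≡ a * c + z * d + a * c
    three-parts P? c d first middle last = trans (range-+ (a + z) a) (cong₂ _+_
      (trans (range-+ a z) (cong₂ _+_ (range-const a c first) (range-const z d middle)))
      (range-const a c last))

    outer-regular : Regular (suc N) (a + a)
    outer-regular = circulant , λ x → trans (circulant-deg x) (trans
      (three-parts outer? 1 0
        (λ {i} i<a → 𝟙-yes (outer? i) (outer-first i<a))
        (λ {i} i<z → 𝟙-no (outer? (a + i)) (inner-middle i<z))
        (λ {i} _ → 𝟙-yes (outer? (a + z + i)) (outer-last i)))
      (simplify a z))
      where
      open Circulant N outer? outer-palindrome
      simplify : ∀ a z → a * 1 + z * 0 + a * 1 ≡ a + a
      simplify = solve-∀

    inner-regular : Regular (suc N) z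
    inner-regular = circulant , λ x → trans (circulant-deg x) (trans
      (three-parts (¬? ∘ outer?) 0 1
        (λ {i} i<a → 𝟙-no (¬? (outer? i)) λ ¬O → ¬O (outer-first i<a))
        (λ {i} i<z → 𝟙-yes (¬? (outer? (a + i))) (inner-middle i<z))
        (λ {i} _ → 𝟙-no (¬? (outer? (a + z + i))) λ ¬O → ¬O (outer-last i)))
      (simplify a z))
      where
      open Circulant N (¬? ∘ outer?) inner-palindrome
      simplify : ∀ a z → a * 0 + z * 1 + a * 0 ≡ z
      simplify = solve-∀

  -- The disjoint union of m complete bipartite graphs with parts of sizes h and
  -- h + 1: the blocks are the intervals of length 2h + 1, and the first h
  -- vertices of a block are joined to its other vertices.
  module Bipartite (m h : ℕ) where

    k = suc (h + h)

    -- Positions of a block on opposite sides of its bipartition.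
    Cross : ℕ → ℕ → Set
    Cross r s = (r < h × ¬ (s < h)) ⊎ (s < h × ¬ (r < h))

    cross? : ∀ r s → Dec (Cross r s)
    cross? r s = ((r <? h) ×-dec ¬? (s <? h)) ⊎-dec ((s <? h) ×-dec ¬? (r <? h))

    -- Same block, opposite sides.
    Adjacent : ℕ → ℕ → Set
    Adjacent x y = y / k ≡ x / k × Cross (x % k) (y % k)

    adjacent? : ∀ x y → Dec (Adjacent x y)
    adjacent? x y = (y / k ≟ x / k) ×-dec cross? (x % k) (y % k)

    bipartite : Graph (m * k)
    bipartite = record
      { _~_      = λ x y → Adjacent (toℕ x) (toℕ y)
      ; _~?_     = λ x y → adjacent? (toℕ x) (toℕ y)
      ; ~-sym    = λ (eq , c) → sym eq , swap c
      ; ~-irrefl = λ (_ , c) → [ (λ (r , ¬r) → ¬r r) , (λ (r , ¬r) → ¬r r) ]′ c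
      }

    open Graph bipartite

    -- The degree of a vertex in position r of its block.
    blockDeg : ℕ → ℕ
    blockDeg r = ∑[ s ← upTo k ] 𝟙 (cross? r s)

    in-block : ∀ {r} b → r < k → (r + b * k) / k ≡ b × (r + b * k) % k ≡ r
    in-block {r} b r<k =
      trans (+-distrib-/-∣ʳ r (n∣m*n b)) (cong₂ _+_ (m<n⇒m/n≡0 r<k) (m*n/n≡m b k)) ,
      trans ([m+kn]%n≡m%n r b k) (m<n⇒m%n≡m r<k)

    deg-blockDeg : ∀ x → deg x ≡ blockDeg (toℕ x % k)
    deg-blockDeg x = begin
      deg x
        ≡⟨ allFin-range (m * k) {λ y → 𝟙 (adjacent? (toℕ x) y)} ⟩
      ∑[ y ← upTo (m * k) ] 𝟙 (adjacent? (toℕ x) y)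
        ≡⟨ range-blocks m k ⟩
      ∑[ b ← upTo m ] ∑[ s ← upTo k ] 𝟙 (adjacent? (toℕ x) (s + b * k))
        ≡⟨ ∑-cong (upTo m) (λ {b} _ → trans (range-cong k (factor b))
             (∑-*ˡ (upTo k) (𝟙 (b ≟ toℕ x / k)))) ⟩
      ∑[ b ← upTo m ] (𝟙 (b ≟ toℕ x / k) * blockDeg (toℕ x % k))
        ≡⟨ range-point (m<n*o⇒m/o<n {n = m} (toℕ<n x)) {λ _ → blockDeg (toℕ x % k)} ⟩
      blockDeg (toℕ x % k) ∎
      where
      open ≡-Reasoning

      𝟙-× : ∀ {P Q : Set} (p : Dec P) (q : Dec Q) → 𝟙 (p ×-dec q) ≡ 𝟙 p * 𝟙 q
      𝟙-× (yes _) q = sym (+-identityʳ (𝟙 q))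
      𝟙-× (no _)  q = refl

      factor : ∀ b {s} → s < k →
        𝟙 (adjacent? (toℕ x) (s + b * k)) ≡ 𝟙 (b ≟ toℕ x / k) * 𝟙 (cross? (toℕ x % k) s)
      factor b {s} s<k = trans
        (𝟙-× ((s + b * k) / k ≟ toℕ x / k) (cross? (toℕ x % k) ((s + b * k) % k)))
        (cong₂ (λ q t → 𝟙 (q ≟ toℕ x / k) * 𝟙 (cross? (toℕ x % k) t))
          (proj₁ (in-block b s<k)) (proj₂ (in-block b s<k)))

    halves : ∀ {f : ℕ → ℕ} c d → (∀ {s} → s < h → f s ≡ c) → (∀ {s} → ¬ (s < h) → f s ≡ d) →
             ∑ (upTo k) f ≡ h * c + suc h * d
    halves {f} c d low high = begin
      ∑ (upTo (suc (h + h))) f  ≡⟨ cong (λ l → ∑ (upTo l) f) (sym (+-suc h h)) ⟩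
      ∑ (upTo (h + suc h)) f    ≡⟨ range-+ h (suc h) ⟩
      ∑ (upTo h) f + ∑[ i ← upTo (suc h) ] f (h + i)
        ≡⟨ cong₂ _+_ (range-const h c low) (range-const (suc h) d λ {i} _ → high (m+n≮m h i)) ⟩
      h * c + suc h * d         ∎
      where open ≡-Reasoning

    blockDeg-low : ∀ {r} → r < h → blockDeg r ≡ suc h
    blockDeg-low {r} r<h = trans (halves 0 1
        (λ {s} s<h → 𝟙-no (cross? r s) [ (λ (_ , s≮h) → s≮h s<h) , (λ (_ , r≮h) → r≮h r<h) ]′)
        (λ {s} s≮h → 𝟙-yes (cross? r s) (inj₁ (r<h , s≮h))))
      (simplify h)
      where
      simplify : ∀ h → h * 0 + suc h * 1 ≡ suc h
      simplify = solve-∀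

    blockDeg-high : ∀ {r} → ¬ (r < h) → blockDeg r ≡ h
    blockDeg-high {r} r≮h = trans (halves 1 0
        (λ {s} s<h → 𝟙-yes (cross? r s) (inj₂ (s<h , r≮h)))
        (λ {s} s≮h → 𝟙-no (cross? r s) [ (λ (r<h , _) → r≮h r<h) , (λ (s<h , _) → s≮h s<h) ]′))
      (simplify h)
      where
      simplify : ∀ h → h * 1 + suc h * 0 ≡ h
      simplify = solve-∀

    bipartite-deg≤ : ∀ x → deg x ≤ k
    bipartite-deg≤ x = subst (_≤ k) (sym (deg-blockDeg x)) (blockDeg≤ (toℕ x % k))
      where
      blockDeg≤ : ∀ r → blockDeg r ≤ k
      blockDeg≤ r with r <? h
      ... | yes r<h = ≤-trans (≤-reflexive (blockDeg-low r<h)) (m≤m+n (suc h) h)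
      ... | no r≮h  = ≤-trans (≤-reflexive (blockDeg-high r≮h)) (m≤n+m h (suc h))

    bipartite-deg+deg : ∀ {x y} → x ~ y → deg x + deg y ≡ k
    bipartite-deg+deg {x} {y} (_ , cross) =
      trans (cong₂ _+_ (deg-blockDeg x) (deg-blockDeg y)) (opposite cross)
      where
      opposite : ∀ {r s} → Cross r s → blockDeg r + blockDeg s ≡ k
      opposite (inj₁ (r<h , s≮h)) = cong₂ _+_ (blockDeg-low r<h) (blockDeg-high s≮h)
      opposite (inj₂ (s<h , r≮h)) =
        trans (cong₂ _+_ (blockDeg-high r≮h) (blockDeg-low s<h)) (+-suc h h)

    bipartite-∑deg : ∑ (allFin (m * k)) deg ≡ 2 * (m * (h * suc h))
    bipartite-∑deg = begin
      ∑ (allFin (m * k)) deg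
        ≡⟨ ∑-cong (allFin (m * k)) (λ {x} _ → deg-blockDeg x) ⟩
      ∑[ x ← allFin (m * k) ] blockDeg (toℕ x % k)
        ≡⟨ allFin-range (m * k) {λ x → blockDeg (x % k)} ⟩
      ∑[ x ← upTo (m * k) ] blockDeg (x % k)
        ≡⟨ range-blocks m k ⟩
      ∑[ b ← upTo m ] ∑[ r ← upTo k ] blockDeg ((r + b * k) % k)
        ≡⟨ range-const m (h * suc h + suc h * h) (λ {b} _ → trans
             (range-cong k λ r<k → cong blockDeg (proj₂ (in-block b r<k)))
             (halves (suc h) h blockDeg-low blockDeg-high)) ⟩
      m * (h * suc h + suc h * h)
        ≡⟨ double m h ⟩
      2 * (m * (h * suc h)) ∎
      where
      open ≡-Reasoning
      double : ∀ m h → m * (h * suc h + suc h * h) ≡ 2 * (m * (h * suc h))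
      double = solve-∀

-- The value of k times the maximum

module Maximum where

  open Sums
  open Graphs
  open UpperBound
  open Constructions
  open import Defs
  open import Data.List using (length; allFin)
  open import Data.List.Properties using (length-tabulate)
  open import Data.Nat
  open import Data.Nat.DivMod using (m*n/n≡m; +-distrib-/-∣ʳ)
  open import Data.Nat.Divisibility using (_∣_; divides; ∣m+n∣m⇒∣n; n∣m*n)
  open import Data.Nat.Primality using (prime[2]; euclidsLemma)
  open import Data.Nat.Properties
  open import Data.Nat.Tactic.RingSolver using (solve-∀)
  open import Data.Product using (∃; _×_; _,_; proj₁; proj₂)
  open import Data.Sum using (_⊎_; inj₁; inj₂)
  open import Function using (id)
  open import Relation.Binary.PropositionalEquality
  open import Relation.Nullary using (¬_; contradiction)

  f-attained : ∀ n k → ∃ λ (𝓕 : Family n) → AlmostFisher k 0 𝓕 × size 𝓕 ≡ f n k 0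
  f-attained n k = proj₁ (proj₂ (maximumSize n k 0))

  f-maximal : ∀ {n} k (𝓕 : Family n) → AlmostFisher k 0 𝓕 → size 𝓕 ≤ f n k 0
  f-maximal {n} k = proj₂ (proj₂ (maximumSize n k 0))

  -- A graph with n q / k edges, where q is the integer part of k² / 4, makes the
  -- upper bound sharp.
  sharp-graph : ∀ {n k} (G : Graph n) → (∀ x → Graph.deg G x ≤ k) →
         (∀ {x y} → Graph._~_ G x y → Graph.deg G x + Graph.deg G y ≤ k) →
         k * ∑ (allFin n) (Graph.deg G) ≡ 2 * (n * (k ^ 2 / 4)) →
         k * f n k 0 ≡ n * (k ^ 2 / 4) + k * n + k
  sharp-graph {n} {k} G deg≤ deg+deg≤ ∑deg = ≤-antisym upper lower
    where
    open ≤-Reasoning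
    open GraphFamily G

    upper : k * f n k 0 ≤ n * (k ^ 2 / 4) + k * n + k
    upper with f-attained n k
    ... | 𝓕 , almost , size≡f =
      subst (λ s → k * s ≤ n * (k ^ 2 / 4) + k * n + k) size≡f (size-bound k 𝓕 almost)

    k*|E| : k * length E ≡ n * (k ^ 2 / 4)
    k*|E| = *-cancelˡ-≡ (k * length E) (n * (k ^ 2 / 4)) 2
      (trans (shuffle k (length E)) (trans (cong (k *_) (sym handshake)) ∑deg))
      where
      shuffle : ∀ k e → 2 * (k * e) ≡ k * (2 * e)
      shuffle = solve-∀

    lower : n * (k ^ 2 / 4) + k * n + k ≤ k * f n k 0
    lower = begin
      n * (k ^ 2 / 4) + k * n + k     ≡⟨ cong (λ m → m + k * n + k) (sym k*|E|) ⟩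
      k * length E + k * n + k        ≡⟨ collect k (length E) n ⟩
      k * suc (n + length E)          ≡⟨ cong (k *_) (sym size-graphFamily) ⟩
      k * size graphFamily            ≤⟨ *-monoʳ-≤ k
        (f-maximal k graphFamily (graphFamily-almostFisher deg≤ deg+deg≤)) ⟩
      k * f n k 0                     ∎
      where
      collect : ∀ k e n → k * e + k * n + k ≡ k * suc (n + e)
      collect = solve-∀

  halve : ∀ n → ∃ λ h → n ≡ h + h ⊎ n ≡ suc (h + h)
  halve zero    = 0 , inj₁ refl
  halve (suc n) with halve n
  ... | h , inj₁ n≡ = h , inj₂ (cong suc n≡)
  ... | h , inj₂ n≡ = suc h , inj₁ (trans (cong suc n≡) (cong suc (sym (+-suc h h))))

  2∣h+h : ∀ h → 2 ∣ h + h
  2∣h+h h = divides h (double h)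
    where
    double : ∀ h → h + h ≡ h * 2
    double = solve-∀

  2∣⇒double : ∀ {n} → 2 ∣ n → ∃ λ h → n ≡ h + h
  2∣⇒double (divides h n≡h*2) = h , trans n≡h*2 (double h)
    where
    double : ∀ h → h * 2 ≡ h + h
    double = solve-∀

  2∤⇒double+1 : ∀ {n} → ¬ (2 ∣ n) → ∃ λ h → n ≡ suc (h + h)
  2∤⇒double+1 {n} 2∤n with halve n
  ... | h , inj₁ refl = contradiction (2∣h+h h) 2∤n
  ... | h , inj₂ n≡   = h , n≡

  -- Among the n - 1 possible distances, an even number h of them is split between
  -- the two ends; if h is odd, n is even and the middle h distances are taken.
  regular-graph : ∀ {n h} → suc h ≤ n → 2 ∣ h * n → Regular n h
  regular-graph {n} {h} h<n 2∣hn with m≤n⇒∃[o]m+o≡n h<n | halve h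
  ... | t , refl | a , inj₁ refl =
    subst (λ N → Regular (suc N) (a + a)) (positions a t) (outer-regular a t)
    where
    positions : ∀ a t → a + t + a ≡ a + a + t
    positions = solve-∀
  ... | t , refl | a , inj₂ refl with 2∣⇒double 2∣t
    where
    2∤h : ¬ (2 ∣ suc (a + a))
    2∤h 2∣h with ∣m+n∣m⇒∣n (subst (2 ∣_) (+-comm 1 (a + a)) 2∣h) (2∣h+h a)
    ... | divides (suc _) ()
    ... | divides zero ()

    2∣t : 2 ∣ t
    2∣t with euclidsLemma (suc (a + a)) (suc (suc (a + a)) + t) prime[2] 2∣hn
    ... | inj₁ 2∣h = contradiction 2∣h 2∤h
    ... | inj₂ 2∣n = ∣m+n∣m⇒∣n 2∣n (subst (2 ∣_) (cong suc (+-suc a a)) (2∣h+h (suc a)))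
  ... | c , refl = subst (λ N → Regular (suc N) h) (positions c a) (inner-regular c h)
    where
    positions : ∀ c a → c + suc (a + a) + c ≡ suc (a + a) + (c + c)
    positions = solve-∀

  scaled-f-even : ∀ {n} h → suc h ≤ n → 2 ∣ h * n →
    let k = h + h in k * f n k 0 ≡ n * (k ^ 2 / 4) + k * n + k
  scaled-f-even {n} h h<n 2∣hn with regular-graph h<n 2∣hn
  ... | G , deg≡h = sharp-graph G
    (λ x → ≤-trans (≤-reflexive (deg≡h x)) (m≤m+n h h))
    (λ {x} {y} _ → ≤-reflexive (cong₂ _+_ (deg≡h x) (deg≡h y)))
    (begin
      (h + h) * ∑ (allFin n) deg  ≡⟨ cong ((h + h) *_) ∑deg ⟩
      (h + h) * (n * h)           ≡⟨ shuffle h n ⟩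
      2 * (n * (h * h))           ≡⟨ cong (λ q → 2 * (n * q)) (sym quarter) ⟩
      2 * (n * ((h + h) ^ 2 / 4)) ∎)
    where
    open Graph G
    open ≡-Reasoning
    ∑deg : ∑ (allFin n) deg ≡ n * h
    ∑deg = trans (∑-cong (allFin n) λ {x} _ → deg≡h x)
      (trans (∑-const (allFin n) h) (cong (_* h) (length-tabulate {n = n} id)))

    shuffle : ∀ h n → (h + h) * (n * h) ≡ 2 * (n * (h * h))
    shuffle = solve-∀

    square : ∀ h → (h + h) * ((h + h) * 1) ≡ h * h * 4
    square = solve-∀

    quarter : (h + h) ^ 2 / 4 ≡ h * h
    quarter = trans (cong (_/ 4) (square h)) (m*n/n≡m (h * h) 4)

  scaled-f-odd : ∀ m h → let k = suc (h + h) ; n = m * k in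
    k * f n k 0 ≡ n * (k ^ 2 / 4) + k * n + k
  scaled-f-odd m h = sharp-graph bipartite bipartite-deg≤
    (λ {x} {y} x~y → ≤-reflexive (bipartite-deg+deg {x} {y} x~y))
    (begin
      k * ∑ (allFin (m * k)) deg         ≡⟨ cong (k *_) bipartite-∑deg ⟩
      k * (2 * (m * (h * suc h)))        ≡⟨ shuffle k m (h * suc h) ⟩
      2 * (m * k * (h * suc h))          ≡⟨ cong (λ q → 2 * (m * k * q)) (sym quarter) ⟩
      2 * (m * k * (k ^ 2 / 4))          ∎)
    where
    open Bipartite m h
    open Graph bipartite
    open ≡-Reasoning
    shuffle : ∀ k m q → k * (2 * (m * q)) ≡ 2 * (m * k * q)
    shuffle = solve-∀

    square : ∀ h → suc (h + h) * (suc (h + h) * 1) ≡ 1 + h * suc h * 4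
    square = solve-∀

    quarter : suc (h + h) ^ 2 / 4 ≡ h * suc h
    quarter = trans (cong (_/ 4) (square h)) (trans
      (+-distrib-/-∣ʳ 1 {d = 4} (n∣m*n (h * suc h))) (m*n/n≡m (h * suc h) 4))

  scaled-f : ∀ n k →
    (2 ∣ k × 4 ∣ k * n × n ≥ k / 2 + 2) ⊎ (¬ (2 ∣ k) × k ∣ n) →
    k * f n k 0 ≡ n * (k ^ 2 / 4) + k * n + k
  scaled-f n k (inj₁ (2∣k , 4∣kn , k/2+2≤n)) with 2∣⇒double 2∣k
  ... | h , refl = scaled-f-even h (begin
      suc h            ≡⟨ +-comm 1 h ⟩
      h + 1            ≤⟨ +-monoʳ-≤ h (s≤s z≤n) ⟩
      h + 2            ≡⟨ cong (_+ 2) (sym half) ⟩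
      (h + h) / 2 + 2  ≤⟨ k/2+2≤n ⟩
      n                ∎) (2∣hn 4∣kn)
    where
    open ≤-Reasoning
    double : ∀ h → h + h ≡ h * 2
    double = solve-∀

    half : (h + h) / 2 ≡ h
    half = trans (cong (_/ 2) (double h)) (m*n/n≡m h 2)

    2∣hn : 4 ∣ (h + h) * n → 2 ∣ h * n
    2∣hn (divides c eq) = divides c (*-cancelʳ-≡ (h * n) (c * 2) 2
      (trans (regroup h n) (trans eq (sym (*-assoc c 2 2)))))
      where
      regroup : ∀ h n → h * n * 2 ≡ (h + h) * n
      regroup = solve-∀
  scaled-f n k (inj₂ (2∤k , divides m refl)) with 2∤⇒double+1 2∤k
  ... | h , refl = scaled-f-odd m h

-- Passage to the rationals

module Rationals where

  open import Data.Integer as ℤ using (ℤ; +_)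
  open import Data.Integer.Properties using (pos-+; pos-*)
  open import Data.Integer.Tactic.RingSolver using (solve-∀)
  open import Data.Nat as ℕ using (ℕ; suc; NonZero)
  open import Data.Rational using (1ℚ; _/_; _+_; _*_; toℚᵘ)
  open import Data.Rational.Properties
    using (toℚᵘ-injective; toℚᵘ-fromℚᵘ; toℚᵘ-homo-+; toℚᵘ-homo-*)
  open import Data.Rational.Unnormalised as ℚᵘ using (mkℚᵘ; *≡*) renaming (_≃_ to _≃ᵘ_)
  open import Data.Rational.Unnormalised.Properties as ℚᵘₚ
    using (≃-refl; +-cong; *-cong)
  open import Relation.Binary.PropositionalEquality

  clear-denominator : ∀ {n q s} k .{{_ : NonZero k}} →
    k ℕ.* s ≡ n ℕ.* q ℕ.+ k ℕ.* n ℕ.+ k →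
    (+ s / 1) ≡ (+ n / k) * (+ q / 1) + (+ n / 1) + 1ℚ
  clear-denominator {n} {q} {s} (suc k-1) eq = toℚᵘ-injective (begin
    toℚᵘ (+ s / 1)
      ≈⟨ toℚᵘ-fromℚᵘ (mkℚᵘ (+ s) 0) ⟩
    mkℚᵘ (+ s) 0
      ≈⟨ *≡* (trans (expand (+ s) (+ k)) (trans (cong (ℤ._* + 1) eqℤ) (collect (+ n) (+ q) (+ k)))) ⟩
    mkℚᵘ (+ n) k-1 ℚᵘ.* mkℚᵘ (+ q) 0 ℚᵘ.+ mkℚᵘ (+ n) 0 ℚᵘ.+ mkℚᵘ (+ 1) 0
      ≈⟨ +-cong (+-cong (*-cong (toℚᵘ-fromℚᵘ (mkℚᵘ (+ n) k-1)) (toℚᵘ-fromℚᵘ (mkℚᵘ (+ q) 0)))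
           (toℚᵘ-fromℚᵘ (mkℚᵘ (+ n) 0))) ≃-refl ⟨
    toℚᵘ (+ n / k) ℚᵘ.* toℚᵘ (+ q / 1) ℚᵘ.+ toℚᵘ (+ n / 1) ℚᵘ.+ toℚᵘ 1ℚ
      ≈⟨ +-cong (+-cong (toℚᵘ-homo-* (+ n / k) (+ q / 1)) ≃-refl) ≃-refl ⟨
    toℚᵘ ((+ n / k) * (+ q / 1)) ℚᵘ.+ toℚᵘ (+ n / 1) ℚᵘ.+ toℚᵘ 1ℚ
      ≈⟨ +-cong (toℚᵘ-homo-+ ((+ n / k) * (+ q / 1)) (+ n / 1)) ≃-refl ⟨
    toℚᵘ ((+ n / k) * (+ q / 1) + (+ n / 1)) ℚᵘ.+ toℚᵘ 1ℚ
      ≈⟨ toℚᵘ-homo-+ ((+ n / k) * (+ q / 1) + (+ n / 1)) 1ℚ ⟨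
    toℚᵘ ((+ n / k) * (+ q / 1) + (+ n / 1) + 1ℚ) ∎)
    where
    open import Relation.Binary.Reasoning.Setoid ℚᵘₚ.≃-setoid
    k = suc k-1

    eqℤ : + k ℤ.* + s ≡ + n ℤ.* + q ℤ.+ + k ℤ.* + n ℤ.+ + k
    eqℤ = trans (sym (pos-* k s)) (trans (cong +_ eq)
      (trans (pos-+ (n ℕ.* q ℕ.+ k ℕ.* n) k) (cong (ℤ._+ + k)
        (trans (pos-+ (n ℕ.* q) (k ℕ.* n)) (cong₂ ℤ._+_ (pos-* n q) (pos-* k n))))))

    expand : ∀ S K → S ℤ.* (K ℤ.* + 1 ℤ.* + 1 ℤ.* + 1) ≡ K ℤ.* S ℤ.* + 1
    expand = solve-∀

    collect : ∀ N Q K → (N ℤ.* Q ℤ.+ K ℤ.* N ℤ.+ K) ℤ.* + 1 ≡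
      ((N ℤ.* Q ℤ.* + 1 ℤ.+ N ℤ.* (K ℤ.* + 1)) ℤ.* + 1 ℤ.+ + 1 ℤ.* (K ℤ.* + 1 ℤ.* + 1)) ℤ.* + 1
    collect = solve-∀

open import Data.Integer using (+_)
open import Data.Nat as ℕ using (ℕ; NonZero; _≥_)
open import Data.Nat.Divisibility using (_∣_)
open import Data.Product using (_×_)
open import Data.Rational using (ℚ; 1ℚ; _/_; _+_; _*_)
open import Data.Sum using (_⊎_)
open import Relation.Binary.PropositionalEquality using (_≡_)
open import Relation.Nullary using (¬_)

mainTheorem2 : ∀ (n k : ℕ) .{{_ : NonZero n}} .{{_ : NonZero k}} →
    (2 ∣ k × 4 ∣ k ℕ.* n × n ≥ k ℕ./ 2 ℕ.+ 2) ⊎ (¬ (2 ∣ k) × k ∣ n) →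
    (+ f n k 0 / 1) ≡ (+ n / k) * (+ (k ℕ.^ 2 ℕ./ 4) / 1) + (+ n / 1) + 1ℚ
mainTheorem2 n k condition =
  Rationals.clear-denominator k (Maximum.scaled-f n k condition)
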